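{- Let $l_\infty$ be a line of $\mathrm{PG}(2,3)$, let $\varphi$ be the Veronese mapping from the points of $\mathrm{PG}(2,3)$ to the points of $\mathrm{PG}(5,3)$, let $\Gamma_\infty:=l_\infty^\varphi$, let $\Delta_\infty$ be the diagonal triangle of the planar quadrangle $\Gamma_\infty$, and let $\mathcal{K}:=(\operatorname{im}\varphi\setminus\Gamma_\infty)\cup\Delta_\infty$. For a set $\mathcal{M}$ of points of $\mathrm{PG}(5,3)$ let $\mathcal{B}(\mathcal{M})$ be the set of all intersections $\mathcal{H}\cap\mathcal{M}$, where $\mathcal{H}$ is a hyperplane of $\mathrm{PG}(5,3)$ with $\#(\mathcal{H}\cap\mathcal{M})>3$. Then the incidence structure $(\mathcal{K},\mathcal{B}(\mathcal{K}),\in)$ is a $5$-$(12,6,1)$ design (Witt's design $W_{12}$). Moreover, such a point model of $W_{12}$ in $\mathrm{PG}(5,3)$ is projectively unique: if $\mathcal{K}'$ is any set of points of $\mathrm{PG}(5,3)$ such that $(\mathcal{K}',\mathcal{B}(\mathcal{K}'),\in)$ is a $5$-$(12,6,1)$ design, then there is a collineation of $\mathrm{PG}(5,3)$ mapping $\mathcal{K}$ onto $\mathcal{K}'$.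
   Context: Let $F=\mathrm{GF}(3)$, let $\mathbf{V}$ be a $3$-dimensional $F$-vector space and $\mathbf{W}=\mathbf{V}\vee\mathbf{V}$ its symmetric tensor square, which has dimension $6$. $\mathrm{PG}(2,3)$ and $\mathrm{PG}(5,3)$ denote the projective spaces on $\mathbf{V}$ and $\mathbf{W}$; their points are the one-dimensional subspaces. The Veronese mapping is $\varphi: F\mathbf{a}\mapsto F(\mathbf{a}\vee\mathbf{a})$; in suitable coordinates, $F(x_0,x_1,x_2)\mapsto F(x_0^2,x_0x_1,x_0x_2,x_1^2,x_1x_2,x_2^2)$. It is injective, and the image under $\varphi$ of a line of $\mathrm{PG}(2,3)$ (viewed as its set of four points) consists of four coplanar points, no three collinear (a planar quadrangle). The diagonal triangle of a quadrangle $\{A,B,C,D\}$ in a projective plane of order $3$ is the set of its three diagonal points $AB\cap CD$, $AC\cap BD$, $AD\cap BC$. A $5$-$(12,6,1)$ design is a $12$-element set of points together with a family of $6$-element subsets (blocks) such that every $5$-element subset of points is contained in exactly one block; it is known to be unique up to isomorphism and is called Witt's design $W_{12}$. A collineation is a bijection of the point set that maps lines onto lines. -}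

module Defs where

open import Level using (0ℓ; suc)
open import Data.Nat as ℕ using (ℕ; pred)
open import Data.Nat.DivMod using (_mod_)
open import Data.Fin using (Fin; zero; toℕ)
open import Data.Fin.Patterns using (0F; 1F; 2F)
open import Data.Fin.Properties using (_≟_; all?)
open import Data.Vec using (Vec; []; _∷_; map; zipWith; replicate; foldr′)
open import Data.Vec.Properties using (map-∘; map-cong; map-id; ∷-injective)
open import Data.Product using (Σ; ∃; _×_; _,_; proj₁; proj₂)
open import Function.Bundles using (Func; Bijection)
open import Relation.Binary.Bundles using (Setoid)
open import Relation.Binary.Definitions using (_Respects_)
import Relation.Binary.Construct.On as On
open import Relation.Binary.PropositionalEquality
  using (_≡_; _≢_; refl; sym; trans; cong; cong₂; setoid)
open import Relation.Nullary.Decidable using (from-yes; _→-dec_)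
open import Relation.Nullary.Negation using (¬_; contradiction)
open import Relation.Unary using (Pred; _∈_; _⊆_; _≐_; _∩_; _∪_; _∖_)

-- GF(3) as the integers modulo 3.

F : Set
F = Fin 3

infixl 6 _+F_
infixl 7 _*F_

_+F_ : F → F → F
a +F b = (toℕ a ℕ.+ toℕ b) mod 3

_*F_ : F → F → F
a *F b = (toℕ a ℕ.* toℕ b) mod 3

*F-assoc : ∀ a b c → (a *F b) *F c ≡ a *F (b *F c)
*F-assoc = from-yes (all? λ a → all? λ b → all? λ c →
  (a *F b) *F c ≟ a *F (b *F c))

*F-identityˡ : ∀ a → 1F *F a ≡ a
*F-identityˡ = from-yes (all? λ a → 1F *F a ≟ a)

*F-interchange : ∀ c a b → (c *F c) *F (a *F b) ≡ (c *F a) *F (c *F b)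
*F-interchange = from-yes (all? λ c → all? λ a → all? λ b →
  (c *F c) *F (a *F b) ≟ (c *F a) *F (c *F b))

square≡0⇒≡0 : ∀ a → a *F a ≡ 0F → a ≡ 0F
square≡0⇒≡0 = from-yes (all? λ a → (a *F a ≟ 0F) →-dec (a ≟ 0F))

≢0⇒square≡1 : ∀ a → a ≢ 0F → a *F a ≡ 1F
≢0⇒square≡1 0F a≢0 = contradiction refl a≢0
≢0⇒square≡1 1F _   = refl
≢0⇒square≡1 2F _   = refl

*F-nonzero : ∀ a b → a ≢ 0F → b ≢ 0F → a *F b ≢ 0F
*F-nonzero 0F _  a≢0 _   _  = a≢0 refl
*F-nonzero 1F 0F _   b≢0 _  = b≢0 refl
*F-nonzero 1F 1F _   _   ()
*F-nonzero 1F 2F _   _   ()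
*F-nonzero 2F 0F _   b≢0 _  = b≢0 refl
*F-nonzero 2F 1F _   _   ()
*F-nonzero 2F 2F _   _   ()

Vector : ℕ → Set
Vector n = Vec F n

0ᵥ : ∀ {n} → Vector n
0ᵥ = replicate _ 0F

infixl 6 _+ᵥ_
infixr 7 _∙_

_+ᵥ_ : ∀ {n} → Vector n → Vector n → Vector n
_+ᵥ_ = zipWith _+F_

_∙_ : ∀ {n} → F → Vector n → Vector n
c ∙ v = map (c *F_) v

∙-assoc : ∀ {n} a b (v : Vector n) → (a *F b) ∙ v ≡ a ∙ (b ∙ v)
∙-assoc a b v = trans (map-cong (*F-assoc a b) v) (map-∘ (a *F_) (b *F_) v)

∙-identity : ∀ {n} (v : Vector n) → 1F ∙ v ≡ v
∙-identity v = trans (map-cong *F-identityˡ v) (map-id v)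

linComb : ∀ {n k} → Vec F k → Vec (Vector n) k → Vector n
linComb cs vs = foldr′ _+ᵥ_ 0ᵥ (zipWith _∙_ cs vs)

LinearlyIndependent : ∀ {n k} → Vec (Vector n) k → Set
LinearlyIndependent vs = ∀ cs → linComb cs vs ≡ 0ᵥ → cs ≡ 0ᵥ

-- A point of PG(n,3) is a one-dimensional subspace F v of Fⁿ⁺¹.  It is
-- represented by a nonzero vector v, and two representatives are equal as
-- points when they are proportional.

Point : ℕ → Set
Point n = Σ (Vector (ℕ.suc n)) (_≢ 0ᵥ)

infix 4 _≈_

_≈_ : ∀ {n} → Point n → Point n → Set
(u , _) ≈ (v , _) = ∃ λ c → c ≢ 0F × c ∙ u ≡ v

PG : ℕ → Setoid 0ℓ 0ℓ
PG n = record
  { Carrier       = Point n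
  ; _≈_           = _≈_
  ; isEquivalence = record
    { refl  = λ {P} → 1F , (λ ()) , ∙-identity (proj₁ P)
    ; sym   = λ {P} {Q} → symmetric P Q
    ; trans = λ {P} {Q} {R} → transitive P Q R
    }
  }
  where
  symmetric : ∀ (P Q : Point n) → P ≈ Q → Q ≈ P
  symmetric (u , _) (._ , _) (c , c≢0 , refl) =
    c , c≢0 , trans (sym (∙-assoc c c u))
                (trans (cong (_∙ u) (≢0⇒square≡1 c c≢0)) (∙-identity u))

  transitive : ∀ (P Q R : Point n) → P ≈ Q → Q ≈ R → P ≈ R
  transitive (u , _) (._ , _) (._ , _) (c , c≢0 , refl) (d , d≢0 , refl) =
    d *F c , *F-nonzero d c d≢0 c≢0 , ∙-assoc d c u

-- Sets of points are predicates on representatives.  Wherever an arbitrary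
-- set of points is quantified over, it is required to respect _≈_.

module _ (S : Setoid 0ℓ 0ℓ) where

  open Setoid S using (Carrier) renaming (_≈_ to _≈ₛ_)

  -- #X = k; elements are counted up to the equality of S.

  HasSize : Pred Carrier 0ℓ → ℕ → Set
  HasSize X k = Bijection (setoid (Fin k)) (On.setoid S (proj₁ {B = X}))

  -- (M , 𝓑 , ∈) is a t-(v,k,1) design.

  record IsSteinerDesign (t v k : ℕ) (M : Pred Carrier 0ℓ)
                         (𝓑 : Pred (Pred Carrier 0ℓ) 0ℓ) : Set (suc 0ℓ) where
    field
      respects    : M Respects _≈ₛ_
      points-size : HasSize M v
      block-⊆     : ∀ X → X ∈ 𝓑 → X ⊆ M
      block-size  : ∀ X → X ∈ 𝓑 → HasSize X k
      block-through :
        ∀ T → T Respects _≈ₛ_ → T ⊆ M → HasSize T t →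
        ∃ λ X → X ∈ 𝓑 × T ⊆ X × (∀ Y → Y ∈ 𝓑 → T ⊆ Y → Y ≐ X)

Image : ∀ {m n} → (Point m → Point n) → Pred (Point m) 0ℓ → Pred (Point n) 0ℓ
Image f X Q = ∃ λ P → P ∈ X × f P ≈ Q

Span : ∀ {n k} → Vec (Vector (ℕ.suc n)) k → Pred (Point n) 0ℓ
Span vs (v , _) = ∃ λ cs → linComb cs vs ≡ v

-- A d-dimensional projective subspace of PG(n,3), i.e. a subspace of Fⁿ⁺¹ of
-- vector space dimension d + 1, given by a basis.

record Flat (n d : ℕ) : Set where
  field
    basis       : Vec (Vector (ℕ.suc n)) (ℕ.suc d)
    independent : LinearlyIndependent basis

  points : Pred (Point n) 0ℓ
  points = Span basis

open Flat public using (points)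

Line : ℕ → Set
Line n = Flat n 1

-- For n ≥ 1.
Hyperplane : ℕ → Set
Hyperplane n = Flat n (pred n)

-- The line AB, for A and B distinct.

join : ∀ {n} → Point n → Point n → Pred (Point n) 0ℓ
join (u , _) (v , _) = Span (u ∷ v ∷ [])

record Collineation (n : ℕ) : Set where
  field
    bijection : Bijection (PG n) (PG n)

  open Bijection bijection public using (to)

  field
    line-image : (l : Line n) → ∃ λ (l′ : Line n) → Image to (points l) ≐ points l′

veronese : Vector 3 → Vector 6
veronese (x₀ ∷ x₁ ∷ x₂ ∷ []) =
  x₀ *F x₀ ∷ x₀ *F x₁ ∷ x₀ *F x₂ ∷ x₁ *F x₁ ∷ x₁ *F x₂ ∷ x₂ *F x₂ ∷ []

veronese-nonzero : ∀ v → v ≢ 0ᵥ → veronese v ≢ 0ᵥ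
veronese-nonzero (x₀ ∷ x₁ ∷ x₂ ∷ []) v≢0 eq
  with p₀ , eq ← ∷-injective eq
  with _  , eq ← ∷-injective eq
  with _  , eq ← ∷-injective eq
  with p₁ , eq ← ∷-injective eq
  with _  , eq ← ∷-injective eq
  with p₂ , _  ← ∷-injective eq =
  v≢0 (cong₂ _∷_ (square≡0⇒≡0 x₀ p₀)
        (cong₂ _∷_ (square≡0⇒≡0 x₁ p₁)
          (cong (_∷ []) (square≡0⇒≡0 x₂ p₂))))

veronese-∙ : ∀ c v → (c *F c) ∙ veronese v ≡ veronese (c ∙ v)
veronese-∙ c (x₀ ∷ x₁ ∷ x₂ ∷ []) =
  cong₂ _∷_ (*F-interchange c x₀ x₀)
    (cong₂ _∷_ (*F-interchange c x₀ x₁)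
      (cong₂ _∷_ (*F-interchange c x₀ x₂)
        (cong₂ _∷_ (*F-interchange c x₁ x₁)
          (cong₂ _∷_ (*F-interchange c x₁ x₂)
            (cong (_∷ []) (*F-interchange c x₂ x₂))))))

-- The Veronese mapping F a ↦ F (a ∨ a).  Coordinates on V ∨ V are taken with
-- respect to the basis eᵢ ∨ eᵢ, 2 (eᵢ ∨ eⱼ) (i < j), which absorbs the factor
-- 2 in a ∨ a = Σ xᵢ² (eᵢ ∨ eᵢ) + Σ 2 xᵢ xⱼ (eᵢ ∨ eⱼ).

φ : Func (PG 2) (PG 5)
φ = record
  { to   = λ (v , v≢0) → veronese v , veronese-nonzero v v≢0
  ; cong = λ { {v , _} (c , c≢0 , refl) →
               c *F c , *F-nonzero c c c≢0 c≢0 , veronese-∙ c v }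
  }

open Func φ public using () renaming (to to φ⟨_⟩)

-- The diagonal points AB ∩ CD of a quadrangle Γ.  When Γ has exactly four
-- points, letting (A , B , C , D) run through all orderings of Γ yields the
-- three points AB ∩ CD, AC ∩ BD and AD ∩ BC.

DiagonalTriangle : ∀ {n} → Pred (Point n) 0ℓ → Pred (Point n) 0ℓ
DiagonalTriangle {n} Γ X =
  ∃ λ (A : Point n) → ∃ λ (B : Point n) → ∃ λ (C : Point n) → ∃ λ (D : Point n) →
    (A ∈ Γ × B ∈ Γ × C ∈ Γ × D ∈ Γ) ×
    (¬ A ≈ B × ¬ A ≈ C × ¬ A ≈ D × ¬ B ≈ C × ¬ B ≈ D × ¬ C ≈ D) ×
    X ∈ join A B ∩ join C D

im-φ : Pred (Point 5) 0ℓ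
im-φ Q = ∃ λ P → φ⟨ P ⟩ ≈ Q

Γ∞ : Line 2 → Pred (Point 5) 0ℓ
Γ∞ l∞ = Image φ⟨_⟩ (points l∞)

Δ∞ : Line 2 → Pred (Point 5) 0ℓ
Δ∞ l∞ = DiagonalTriangle (Γ∞ l∞)

𝓚 : Line 2 → Pred (Point 5) 0ℓ
𝓚 l∞ = (im-φ ∖ Γ∞ l∞) ∪ Δ∞ l∞

𝓑 : Pred (Point 5) 0ℓ → Pred (Pred (Point 5) 0ℓ) 0ℓ
𝓑 M X = ∃ λ (H : Hyperplane 5) →
  X ≐ points H ∩ M ×
  (∃ λ k → k ℕ.> 3 × HasSize (PG 5) (points H ∩ M) k)

-- A 12-set K is a 5-(12,6,1) design of hyperplane sections exactly when its points, in suitable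
-- coordinates, are the columns of the generator matrix [ I | C ] of the extended ternary Golay
-- code, C being a symmetric conference matrix of order 6.
--
-- Code words correspond to hyperplanes and zeros of a word to points of K in the hyperplane.
-- As a word of [ I | C ] has at most three or exactly six zeros, every block has six points; any
-- five columns are independent, so they span the only hyperplane through them.
--
-- Conversely, in a design any five points are independent: otherwise they lie together with any
-- further point in a hyperplane, so that their block would be all of K.  Take six independent
-- points as basis.  The block through five of them contains exactly one other point, which gives
-- six points whose coordinate vectors have precisely one zero, in different places.
-- Independence of any five points also says that any combination of two of these vectors has
-- at most two zeros.  After rescaling, only twelve matrices remain, one for each pentagon on five
-- labelled vertices, and they differ by a permutation of the coordinates.
--
-- The set 𝓚 is reduced to the case l∞ : x₀ = 0 by the symmetric square of a linear map, and there
-- six of its points can be chosen so that the other six have the columns of C as coordinates.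
--
-- Both halves combine to the uniqueness: any two such sets are linear images of the same one.

module Submission where

open import Defs
open import Level using (0ℓ)
open import Data.Bool using (true; false)
open import Data.Fin using (Fin; zero; suc; combine; remQuot; punchIn; punchOut; _↑ˡ_)
open import Data.Fin.Patterns
open import Data.Fin.Properties
  using (_≟_; all?; any?; combine-injective; combine-remQuot; injective⇒≤; suc-injective;
         punchIn-injective; punchInᵢ≢i; punchIn-punchOut; ↑ˡ-injective)
open import Data.Fin.Subset using (Subset; ∣_∣)
open import Data.Fin.Subset.Properties using (∣p∣≤n)
open import Data.Nat as ℕ
  using (ℕ; zero; suc; _≤_; _<_; z≤n; s≤s; _^_; _≤′_; ≤′-refl; ≤′-step)
import Data.Nat.Properties as ℕ
open import Data.Product using (∃; _×_; _,_; proj₁; proj₂)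
open import Data.Sum using (_⊎_; inj₁; inj₂)
open import Data.Vec
  using (Vec; []; _∷_; _++_; head; tail; map; zipWith; replicate; lookup; tabulate)
import Data.Vec as Vec
open import Data.Vec.Properties
  using (≡-dec; ∷-injective; map-∘; map-cong; map-replicate; tabulate-∘; tabulate-cong;
         tabulate∘lookup; lookup∘tabulate; lookup-map; lookup-replicate; lookup-zipWith;
         zipWith-assoc; zipWith-identityˡ; zipWith-identityʳ; zipWith-distribˡ)
open import Function using (_∘_; id)
open import Function.Bundles using (Bijection)
open import Function.Definitions using (Injective)
open import Relation.Binary.Bundles using (Setoid)
open import Relation.Binary.Definitions using (_Respects_)
open import Relation.Binary.PropositionalEquality hiding (setoid)
open import Relation.Nullary using (¬_; Dec; yes; no; does; contradiction)
open import Relation.Nullary.Decidable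
  using (from-yes; map′; _→-dec_; _×-dec_; _⊎-dec_; ¬?; dec-true; decidable-stable)
open import Relation.Unary using (Pred; Decidable; _∈_; _⊆_; _≐_; _∩_; _∖_)

private variable
  j k m n : ℕ

-- Linear algebra over GF(3)

opaque
  +F-assoc : ∀ a b c → (a +F b) +F c ≡ a +F (b +F c)
  +F-assoc = from-yes (all? λ a → all? λ b → all? λ c → (a +F b) +F c ≟ a +F (b +F c))

  +F-identityˡ : ∀ a → 0F +F a ≡ a
  +F-identityˡ = from-yes (all? λ a → 0F +F a ≟ a)

  +F-identityʳ : ∀ a → a +F 0F ≡ a
  +F-identityʳ = from-yes (all? λ a → a +F 0F ≟ a)

  +F-interchange : ∀ a b c d → (a +F b) +F (c +F d) ≡ (a +F c) +F (b +F d)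
  +F-interchange = from-yes (all? λ a → all? λ b → all? λ c → all? λ d →
    (a +F b) +F (c +F d) ≟ (a +F c) +F (b +F d))

  *F-comm : ∀ a b → a *F b ≡ b *F a
  *F-comm = from-yes (all? λ a → all? λ b → a *F b ≟ b *F a)

  *F-distribˡ : ∀ a b c → a *F (b +F c) ≡ a *F b +F a *F c
  *F-distribˡ = from-yes (all? λ a → all? λ b → all? λ c → a *F (b +F c) ≟ a *F b +F a *F c)

  *F-distribʳ : ∀ a b c → (a +F b) *F c ≡ a *F c +F b *F c
  *F-distribʳ = from-yes (all? λ a → all? λ b → all? λ c → (a +F b) *F c ≟ a *F c +F b *F c)

  -- Subtraction is expressed throughout as adding a multiple by `2F`, which is -1 in GF(3).
  +F-2*-cancel : ∀ a b → a +F 2F *F b ≡ 0F → a ≡ b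
  +F-2*-cancel = from-yes (all? λ a → all? λ b → (a +F 2F *F b ≟ 0F) →-dec (a ≟ b))

  +F-2*-inverse : ∀ a → a +F 2F *F a ≡ 0F
  +F-2*-inverse = from-yes (all? λ a → a +F 2F *F a ≟ 0F)

infix 4 _≟ᵥ_
_≟ᵥ_ : (u v : Vector n) → Dec (u ≡ v)
_≟ᵥ_ = ≡-dec _≟_

+ᵥ-identityˡ : (v : Vector n) → 0ᵥ +ᵥ v ≡ v
+ᵥ-identityˡ = zipWith-identityˡ +F-identityˡ

+ᵥ-identityʳ : (v : Vector n) → v +ᵥ 0ᵥ ≡ v
+ᵥ-identityʳ = zipWith-identityʳ +F-identityʳ

+ᵥ-interchange : (u v w x : Vector n) → (u +ᵥ v) +ᵥ (w +ᵥ x) ≡ (u +ᵥ w) +ᵥ (v +ᵥ x)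
+ᵥ-interchange []      []      []      []      = refl
+ᵥ-interchange (a ∷ u) (b ∷ v) (c ∷ w) (d ∷ x) =
  cong₂ _∷_ (+F-interchange a b c d) (+ᵥ-interchange u v w x)

∙-distribˡ : ∀ c (u v : Vector n) → c ∙ (u +ᵥ v) ≡ c ∙ u +ᵥ c ∙ v
∙-distribˡ c []      []      = refl
∙-distribˡ c (a ∷ u) (b ∷ v) = cong₂ _∷_ (*F-distribˡ c a b) (∙-distribˡ c u v)

∙-distribʳ : ∀ a b (v : Vector n) → (a +F b) ∙ v ≡ a ∙ v +ᵥ b ∙ v
∙-distribʳ a b []      = refl
∙-distribʳ a b (c ∷ v) = cong₂ _∷_ (*F-distribʳ a b c) (∙-distribʳ a b v)

∙-zeroˡ : (v : Vector n) → 0F ∙ v ≡ 0ᵥ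
∙-zeroˡ []      = refl
∙-zeroˡ (a ∷ v) = cong (0F ∷_) (∙-zeroˡ v)

∙-zeroʳ : ∀ c → c ∙ 0ᵥ {n} ≡ 0ᵥ
∙-zeroʳ {n} c = trans (map-replicate (c *F_) 0F n) (cong (replicate n) (*F-comm c 0F))

+ᵥ-2∙-cancel : (u v : Vector n) → u +ᵥ 2F ∙ v ≡ 0ᵥ → u ≡ v
+ᵥ-2∙-cancel []      []      _  = refl
+ᵥ-2∙-cancel (a ∷ u) (b ∷ v) eq =
  cong₂ _∷_ (+F-2*-cancel a b (proj₁ (∷-injective eq))) (+ᵥ-2∙-cancel u v (proj₂ (∷-injective eq)))

+ᵥ-2∙-inverse : (v : Vector n) → v +ᵥ 2F ∙ v ≡ 0ᵥ
+ᵥ-2∙-inverse []      = refl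
+ᵥ-2∙-inverse (a ∷ v) = cong₂ _∷_ (+F-2*-inverse a) (+ᵥ-2∙-inverse v)

∙-involutive : ∀ c → c ≢ 0F → (v : Vector n) → c ∙ c ∙ v ≡ v
∙-involutive c c≢0 v =
  trans (sym (∙-assoc c c v)) (trans (cong (_∙ v) (≢0⇒square≡1 c c≢0)) (∙-identity v))

infix 4 _∼_
-- The relation `_≈_` on bare vectors, without proofs of being nonzero, so that exhaustive search
-- can decide it.
_∼_ : Vector n → Vector n → Set
u ∼ v = ∃ λ c → c ≢ 0F × c ∙ u ≡ v

_∼?_ : (u v : Vector n) → Dec (u ∼ v)
u ∼? v = any? λ c → ¬? (c ≟ 0F) ×-dec (c ∙ u ≟ᵥ v)

record Linear (f : Vector m → Vector n) : Set where
  field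
    +-homo : ∀ u v → f (u +ᵥ v) ≡ f u +ᵥ f v
    ∙-homo : ∀ c v → f (c ∙ v) ≡ c ∙ f v

  0-homo : f 0ᵥ ≡ 0ᵥ
  0-homo = trans (cong f (sym (∙-zeroˡ 0ᵥ))) (trans (∙-homo 0F 0ᵥ) (∙-zeroˡ (f 0ᵥ)))

  linComb-homo : (cs : Vector k) (vs : Vec (Vector m) k) →
                 f (linComb cs vs) ≡ linComb cs (map f vs)
  linComb-homo []       []       = 0-homo
  linComb-homo (c ∷ cs) (v ∷ vs) =
    trans (+-homo (c ∙ v) (linComb cs vs)) (cong₂ _+ᵥ_ (∙-homo c v) (linComb-homo cs vs))

  kernel-0⇒injective : (∀ v → f v ≡ 0ᵥ → v ≡ 0ᵥ) → ∀ {u v} → f u ≡ f v → u ≡ v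
  kernel-0⇒injective ker {u} {v} eq = +ᵥ-2∙-cancel u v (ker _ (begin
    f (u +ᵥ 2F ∙ v)     ≡⟨ +-homo u (2F ∙ v) ⟩
    f u +ᵥ f (2F ∙ v)   ≡⟨ cong₂ _+ᵥ_ eq (∙-homo 2F v) ⟩
    f v +ᵥ 2F ∙ f v     ≡⟨ +ᵥ-2∙-inverse (f v) ⟩
    0ᵥ                  ∎))
    where open ≡-Reasoning

open Linear

∘-linear : {f : Vector m → Vector n} {g : Vector k → Vector m} →
           Linear f → Linear g → Linear (f ∘ g)
∘-linear {f = f} {g} F-lin G-lin = record
  { +-homo = λ u v → trans (cong f (+-homo G-lin u v)) (+-homo F-lin (g u) (g v))
  ; ∙-homo = λ c v → trans (cong f (∙-homo G-lin c v)) (∙-homo F-lin c (g v))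
  }

linComb-linear : (vs : Vec (Vector n) k) → Linear (λ cs → linComb cs vs)
linComb-linear vs = record { +-homo = plus vs ; ∙-homo = scale vs }
  where
  plus : (vs : Vec (Vector n) k) (cs ds : Vector k) →
         linComb (cs +ᵥ ds) vs ≡ linComb cs vs +ᵥ linComb ds vs
  plus []       []       []       = sym (+ᵥ-identityˡ 0ᵥ)
  plus (v ∷ vs) (c ∷ cs) (d ∷ ds) =
    trans (cong₂ _+ᵥ_ (∙-distribʳ c d v) (plus vs cs ds))
          (+ᵥ-interchange (c ∙ v) (d ∙ v) (linComb cs vs) (linComb ds vs))
  scale : (vs : Vec (Vector n) k) → ∀ a (cs : Vector k) →
          linComb (a ∙ cs) vs ≡ a ∙ linComb cs vs
  scale []       a []       = sym (∙-zeroʳ a)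
  scale (v ∷ vs) a (c ∷ cs) =
    trans (cong₂ _+ᵥ_ (∙-assoc a c v) (scale vs a cs))
          (sym (∙-distribˡ a (c ∙ v) (linComb cs vs)))

linComb-0F∷ : (cs : Vector k) (v : Vector n) (vs : Vec (Vector n) k) →
              linComb (0F ∷ cs) (v ∷ vs) ≡ linComb cs vs
linComb-0F∷ cs v vs = trans (cong (_+ᵥ linComb cs vs) (∙-zeroˡ v)) (+ᵥ-identityˡ (linComb cs vs))

linComb-∘ : (cs : Vector m) (us : Vec (Vector k) m) (vs : Vec (Vector n) k) →
            linComb (linComb cs us) vs ≡ linComb cs (map (λ u → linComb u vs) us)
linComb-∘ cs us vs = linComb-homo (linComb-linear vs) cs us

unit : Fin n → Vector n
unit zero    = 1F ∷ 0ᵥ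
unit (suc i) = 0F ∷ unit i

basis : ∀ n → Vec (Vector n) n
basis n = tabulate unit

linComb-0∷ : (cs : Vector k) (vs : Vec (Vector n) k) →
             linComb cs (map (0F ∷_) vs) ≡ 0F ∷ linComb cs vs
linComb-0∷ cs vs = sym (linComb-homo
  (record { +-homo = λ _ _ → refl ; ∙-homo = λ c v → cong (_∷ (c ∙ v)) (*F-comm 0F c) }) cs vs)

linComb-basis : (v : Vector n) → linComb v (basis n) ≡ v
linComb-basis []      = refl
linComb-basis {suc n} (a ∷ v) = begin
  a ∙ (1F ∷ 0ᵥ) +ᵥ linComb v (tabulate (unit ∘ suc))
    ≡⟨ cong (λ us → a ∙ (1F ∷ 0ᵥ) +ᵥ linComb v us) (tabulate-∘ (0F ∷_) unit) ⟩
  a ∙ (1F ∷ 0ᵥ) +ᵥ linComb v (map (0F ∷_) (basis n))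
    ≡⟨ cong₂ _+ᵥ_ (cong₂ _∷_ (trans (*F-comm a 1F) (*F-identityˡ a)) (∙-zeroʳ a))
                  (trans (linComb-0∷ v (basis n)) (cong (0F ∷_) (linComb-basis v))) ⟩
  (a ∷ 0ᵥ) +ᵥ (0F ∷ v)
    ≡⟨ cong₂ _∷_ (+F-identityʳ a) (+ᵥ-identityˡ v) ⟩
  a ∷ v ∎
  where open ≡-Reasoning

linComb-unit : (i : Fin k) (vs : Vec (Vector n) k) → linComb (unit i) vs ≡ lookup vs i
linComb-unit zero (v ∷ vs) =
  trans (cong₂ _+ᵥ_ (∙-identity v) (0-homo (linComb-linear vs))) (+ᵥ-identityʳ v)
linComb-unit (suc i) (v ∷ vs) =
  trans (linComb-0F∷ (unit i) v vs) (linComb-unit i vs)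

-- Exhaustive search and counting in vector spaces over GF(3)

anyᵥ? : {P : Pred (Vector n) 0ℓ} → Decidable P → Dec (∃ P)
anyᵥ? {zero}  P? = map′ ([] ,_) (λ { ([] , p) → p }) (P? [])
anyᵥ? {suc n} P? = map′ (λ (a , v , p) → a ∷ v , p) (λ { (a ∷ v , p) → a , v , p })
                        (any? λ a → anyᵥ? λ v → P? (a ∷ v))

allᵥ? : {P : Pred (Vector n) 0ℓ} → Decidable P → Dec (∀ v → P v)
allᵥ? {zero}  P? = map′ (λ { p [] → p }) (λ p → p []) (P? [])
allᵥ? {suc n} P? = map′ (λ { p (a ∷ v) → p a v }) (λ p a v → p (a ∷ v))
                        (all? λ a → allᵥ? λ v → P? (a ∷ v))

-- Numbering the vectors turns statements about dimension into the pigeonhole principle.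
encode : Vector n → Fin (3 ^ n)
encode []      = zero
encode (a ∷ v) = combine a (encode v)

encode-injective : (u v : Vector n) → encode u ≡ encode v → u ≡ v
encode-injective []      []      _  = refl
encode-injective (a ∷ u) (b ∷ v) eq
  with a≡b , eq′ ← combine-injective a (encode u) b (encode v) eq =
  cong₂ _∷_ a≡b (encode-injective u v eq′)

decode : Fin (3 ^ n) → Vector n
decode {zero}  _ = []
decode {suc n} i = let a , j = remQuot {3} (3 ^ n) i in a ∷ decode j

decode-injective : (i j : Fin (3 ^ n)) → decode {n} i ≡ decode j → i ≡ j
decode-injective {zero}  zero zero _ = refl
decode-injective {suc n} i j eq
  with a≡b , eq′ ← ∷-injective eq = begin
  i                    ≡⟨ sym (combine-remQuot {3} (3 ^ n) i) ⟩
  combine a i′         ≡⟨ cong₂ combine a≡b (decode-injective i′ j′ eq′) ⟩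
  combine b j′         ≡⟨ combine-remQuot {3} (3 ^ n) j ⟩
  j                    ∎
  where
  open ≡-Reasoning
  a = proj₁ (remQuot {3} (3 ^ n) i)
  b = proj₁ (remQuot {3} (3 ^ n) j)
  i′ = proj₂ (remQuot {3} (3 ^ n) i)
  j′ = proj₂ (remQuot {3} (3 ^ n) j)

3^-cancel-≤ : 3 ^ m ≤ 3 ^ n → m ≤ n
3^-cancel-≤ {m} {n} le = ℕ.≮⇒≥ λ n<m → ℕ.≤⇒≯ le (ℕ.^-monoʳ-< 3 (s≤s (s≤s z≤n)) n<m)

-- Counting takes the place of the exchange lemma: an injection yields `3 ^ m ≤ 3 ^ n`.
vector-injective⇒≤ : (f : Vector m → Vector n) → (∀ {u v} → f u ≡ f v → u ≡ v) → m ≤ n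
vector-injective⇒≤ f inj = 3^-cancel-≤ (injective⇒≤ {f = encode ∘ f ∘ decode}
  (λ eq → decode-injective _ _ (inj (encode-injective _ _ eq))))

opaque
  -- If `i` were missed, mapping one additional element to `i` would give an injection of `suc n`
  -- elements into `n`.
  Fin-injective⇒surjective : (f : Fin n → Fin n) → (∀ {i j} → f i ≡ f j → i ≡ j) →
                             ∀ i → ∃ λ j → f j ≡ i
  Fin-injective⇒surjective {n} f inj i with any? (λ j → f j ≟ i)
  ... | yes found = found
  ... | no  none  = contradiction (injective⇒≤ g-injective) (ℕ.<-irrefl refl)
    where
    g : Fin (suc n) → Fin n
    g zero    = i
    g (suc j) = f j
    g-injective : ∀ {j k} → g j ≡ g k → j ≡ k
    g-injective {zero}  {zero}  _  = refl
    g-injective {zero}  {suc k} eq = contradiction (k , sym eq) none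
    g-injective {suc j} {zero}  eq = contradiction (j , eq) none
    g-injective {suc j} {suc k} eq = cong suc (inj eq)

  injective⇒surjective : (f : Vector n → Vector n) → (∀ {u v} → f u ≡ f v → u ≡ v) →
                         ∀ v → ∃ λ u → f u ≡ v
  injective⇒surjective f inj v
    with i , eq ← Fin-injective⇒surjective (encode ∘ f ∘ decode)
           (λ eq → decode-injective _ _ (inj (encode-injective _ _ eq))) (encode v) =
    decode i , encode-injective _ _ eq

-- Invertible linear maps

record Iso (n : ℕ) : Set where
  field
    to       : Vector n → Vector n
    from     : Vector n → Vector n
    linear   : Linear to
    to∘from  : ∀ v → to (from v) ≡ v
    from∘to  : ∀ v → from (to v) ≡ v

  to-injective : ∀ {u v} → to u ≡ to v → u ≡ v
  to-injective eq = trans (sym (from∘to _)) (trans (cong from eq) (from∘to _))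

  from-linear : Linear from
  from-linear = record
    { +-homo = λ u v → to-injective (trans (to∘from _)
        (sym (trans (+-homo linear _ _) (cong₂ _+ᵥ_ (to∘from u) (to∘from v)))))
    ; ∙-homo = λ c v → to-injective (trans (to∘from _)
        (sym (trans (∙-homo linear c (from v)) (cong (c ∙_) (to∘from v)))))
    }

  to-≢0 : ∀ {v} → v ≢ 0ᵥ → to v ≢ 0ᵥ
  to-≢0 v≢0 eq = v≢0 (to-injective (trans eq (sym (0-homo linear))))

-- A trivial kernel makes `f` injective, and on a finite space an injective self-map is onto; its
-- preimages supply the inverse.
iso : (f : Vector n → Vector n) → Linear f → (∀ v → f v ≡ 0ᵥ → v ≡ 0ᵥ) → Iso n
iso f f-linear ker = record
  { to      = f
  ; from    = λ v → proj₁ (surj v)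
  ; linear  = f-linear
  ; to∘from = λ v → proj₂ (surj v)
  ; from∘to = λ v → inj (proj₂ (surj (f v)))
  }
  where
  inj : ∀ {u v} → f u ≡ f v → u ≡ v
  inj = kernel-0⇒injective f-linear ker
  surj = injective⇒surjective f inj

independent⇒iso : (vs : Vec (Vector n) n) → LinearlyIndependent vs → Iso n
independent⇒iso vs ind = iso (λ cs → linComb cs vs) (linComb-linear vs) ind

infixr 9 _∘-iso_
_∘-iso_ : Iso n → Iso n → Iso n
f ∘-iso g = record
  { to      = F.to ∘ G.to
  ; from    = G.from ∘ F.from
  ; linear  = ∘-linear F.linear G.linear
  ; to∘from = λ v → trans (cong F.to (G.to∘from _)) (F.to∘from v)
  ; from∘to = λ v → trans (cong G.from (F.from∘to _)) (G.from∘to v)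
  }
  where module F = Iso f
        module G = Iso g

flip-iso : Iso n → Iso n
flip-iso f = record
  { to = from ; from = to ; linear = from-linear ; to∘from = from∘to ; from∘to = to∘from }
  where open Iso f

-- Spans, bases and hyperplanes

InSpan : Vec (Vector n) k → Vector n → Set
InSpan vs v = ∃ λ cs → linComb cs vs ≡ v

opaque
  inSpan? : (vs : Vec (Vector n) k) → Decidable (InSpan vs)
  inSpan? vs v = anyᵥ? λ cs → linComb cs vs ≟ᵥ v

lookup-inSpan : (vs : Vec (Vector n) k) (i : Fin k) → InSpan vs (lookup vs i)
lookup-inSpan vs i = unit i , linComb-unit i vs

independent-∷ : {w : Vector n} {vs : Vec (Vector n) k} →
                ¬ InSpan vs w → LinearlyIndependent vs → LinearlyIndependent (w ∷ vs)
independent-∷ {w = w} {vs} w∉ ind (c ∷ cs) eq with c ≟ 0F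
... | yes refl = cong (0F ∷_) (ind cs (begin
  linComb cs vs               ≡⟨ sym (linComb-0F∷ cs w vs) ⟩
  linComb (0F ∷ cs) (w ∷ vs)  ≡⟨ eq ⟩
  0ᵥ                          ∎))
  where open ≡-Reasoning
-- The relation is solved for `w`: -1 is `2F`, and `c` is its own inverse.
... | no c≢0 = contradiction (c ∙ 2F ∙ cs , (begin
  linComb (c ∙ 2F ∙ cs) vs    ≡⟨ ∙-homo (linComb-linear vs) c (2F ∙ cs) ⟩
  c ∙ linComb (2F ∙ cs) vs    ≡⟨ cong (c ∙_) (∙-homo (linComb-linear vs) 2F cs) ⟩
  c ∙ 2F ∙ linComb cs vs      ≡⟨ cong (c ∙_) (sym (+ᵥ-2∙-cancel (c ∙ w) _
                                   (trans (cong (c ∙ w +ᵥ_) (∙-involutive 2F (λ ()) _)) eq))) ⟩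
  c ∙ c ∙ w                   ≡⟨ ∙-involutive c c≢0 w ⟩
  w                           ∎)) w∉
  where open ≡-Reasoning

opaque
  -- If everything lay in the span, choosing coefficients would inject a space of dimension `n` into
  -- one of dimension `k`.
  outside-span : k < n → (vs : Vec (Vector n) k) → ∃ λ w → ¬ InSpan vs w
  outside-span k<n vs with anyᵥ? (λ w → ¬? (inSpan? vs w))
  ... | yes found = found
  ... | no  none  = contradiction
    (vector-injective⇒≤ (proj₁ ∘ spans) λ {u} {v} eq →
       trans (sym (proj₂ (spans u))) (trans (cong (λ cs → linComb cs vs) eq) (proj₂ (spans v))))
    (ℕ.<⇒≱ k<n)
    where
    spans : ∀ w → InSpan vs w
    spans w = decidable-stable (inSpan? vs w) (λ w∉ → none (w , w∉))

extend : ∀ {j} → k ≤′ j → j ≤ n → (vs : Vec (Vector n) k) → LinearlyIndependent vs →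
         ∃ λ (ws : Vec (Vector n) j) →
           LinearlyIndependent ws × (∀ {v} → InSpan vs v → InSpan ws v)
extend ≤′-refl       _   vs ind = vs , ind , id
extend (≤′-step k≤j) j<n vs ind
  with ws , ws-ind , vs⊆ws ← extend k≤j (ℕ.<⇒≤ j<n) vs ind
  with w , w∉ ← outside-span j<n ws =
  w ∷ ws , independent-∷ w∉ ws-ind , λ v∈ →
    let cs , eq = vs⊆ws v∈ in
    0F ∷ cs , trans (linComb-0F∷ cs w ws) eq

-- Linear coordinates on Fⁿ⁺¹ in which a given hyperplane is the kernel of the firstColumn one.
module HyperplaneCoordinates (vs : Vec (Vector (suc n)) n) (ind : LinearlyIndependent vs) where

  private
    w∉vs : ∃ λ w → ¬ InSpan vs w
    w∉vs = outside-span (ℕ.n<1+n n) vs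

  coordinates : Iso (suc n)
  coordinates = independent⇒iso (proj₁ w∉vs ∷ vs) (independent-∷ (proj₂ w∉vs) ind)

  open Iso coordinates

  to-0F∷ : ∀ cs → to (0F ∷ cs) ≡ linComb cs vs
  to-0F∷ cs = linComb-0F∷ cs (proj₁ w∉vs) vs

  inSpan⇒head≡0 : ∀ v → InSpan vs v → head (from v) ≡ 0F
  inSpan⇒head≡0 _ (cs , refl) = cong head (trans (cong from (sym (to-0F∷ cs))) (from∘to (0F ∷ cs)))

  head≡0⇒inSpan : ∀ v → head (from v) ≡ 0F → InSpan vs v
  head≡0⇒inSpan v eq with from v | to∘from v
  head≡0⇒inSpan v refl | 0F ∷ cs | to-eq = cs , trans (sym (to-0F∷ cs)) to-eq

linComb-inSpan : (us : Vec (Vector n) m) (ws : Vec (Vector n) k) →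
                 (∀ i → InSpan ws (lookup us i)) →
                 ∃ λ (M : Vec (Vector k) m) → ∀ cs → linComb (linComb cs M) ws ≡ linComb cs us
linComb-inSpan us ws us∈ = M , λ cs → trans (linComb-∘ cs M ws) (cong (linComb cs) (begin
  map (λ c → linComb c ws) M                     ≡⟨ sym (tabulate-∘ (λ c → linComb c ws) (proj₁ ∘ us∈)) ⟩
  tabulate (λ i → linComb (proj₁ (us∈ i)) ws)    ≡⟨ tabulate-cong (proj₂ ∘ us∈) ⟩
  tabulate (lookup us)                           ≡⟨ tabulate∘lookup us ⟩
  us                                             ∎))
  where
  open ≡-Reasoning
  M = tabulate (proj₁ ∘ us∈)

span-mono : (us : Vec (Vector n) m) (ws : Vec (Vector n) k) →
            (∀ i → InSpan ws (lookup us i)) → ∀ {v} → InSpan us v → InSpan ws v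
span-mono us ws us∈ (cs , eq) with M , h ← linComb-inSpan us ws us∈ = linComb cs M , trans (h cs) eq

-- The square matrix expressing `us` through `ws` has a trivial kernel because `us` is independent;
-- its inverse expresses combinations of `ws` through `us`.
span-maximal : (us ws : Vec (Vector n) k) → LinearlyIndependent us →
               (∀ i → InSpan ws (lookup us i)) → ∀ {v} → InSpan ws v → InSpan us v
span-maximal us ws ind us∈ (ds , eq) with M , h ← linComb-inSpan us ws us∈ =
  from ds , trans (sym (h (from ds))) (trans (cong (λ cs → linComb cs ws) (to∘from ds)) eq)
  where
  open Iso (independent⇒iso M λ cs M≡0 →
    ind cs (trans (sym (h cs)) (trans (cong (λ c → linComb c ws) M≡0) (0-homo (linComb-linear ws)))))

-- Intended for six vectors of F⁶: if they are dependent, at most five independent vectors span them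
-- all, and these extend to the basis of a hyperplane.
independent-or-redundant :
  (ws : Vec (Vector n) k) → LinearlyIndependent ws ⊎
  ∃ λ r → r < k × ∃ λ (us : Vec (Vector n) r) →
    LinearlyIndependent us × (∀ i → InSpan us (lookup ws i))
independent-or-redundant [] = inj₁ λ { [] _ → refl }
independent-or-redundant (w ∷ ws) with independent-or-redundant ws
... | inj₁ ind with inSpan? ws w
...   | yes w∈ = inj₂ (_ , ℕ.n<1+n _ , ws , ind , λ { zero → w∈ ; (suc i) → lookup-inSpan ws i })
...   | no  w∉ = inj₁ (independent-∷ w∉ ind)
independent-or-redundant (w ∷ ws) | inj₂ (r , r<k , us , ind , ws⊆) with inSpan? us w
...   | yes w∈ = inj₂ (r , ℕ.m<n⇒m<1+n r<k , us , ind , λ { zero → w∈ ; (suc i) → ws⊆ i })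
...   | no  w∉ = inj₂ (suc r , s≤s r<k , w ∷ us , independent-∷ w∉ ind , λ
  { zero    → lookup-inSpan (w ∷ us) zero
  ; (suc i) → span-mono us (w ∷ us) (λ j → lookup-inSpan (w ∷ us) (suc j)) (ws⊆ i) })

-- Sets of projective points and their sizes

≈-refl : (P : Point n) → P ≈ P
≈-refl {n} P = Setoid.refl (PG n) {P}

≈-sym : (P Q : Point n) → P ≈ Q → Q ≈ P
≈-sym {n} P Q = Setoid.sym (PG n) {P} {Q}

≈-trans : (P Q R : Point n) → P ≈ Q → Q ≈ R → P ≈ R
≈-trans {n} P Q R = Setoid.trans (PG n) {P} {Q} {R}

Distinct : (Fin k → Point n) → Set
Distinct p = ∀ {i j} → p i ≈ p j → i ≡ j

⟦_⟧ : (Fin k → Point n) → Pred (Point n) 0ℓ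
⟦ p ⟧ X = ∃ λ i → p i ≈ X

⟦⟧-respects : (p : Fin k → Point n) → ⟦ p ⟧ Respects _≈_
⟦⟧-respects p {X} {Y} X≈Y (i , eq) = i , ≈-trans (p i) X Y eq X≈Y

⟦⟧-size : (p : Fin k → Point n) → Distinct p → HasSize (PG n) ⟦ p ⟧ k
⟦⟧-size p distinct = record
  { to        = λ i → p i , i , ≈-refl (p i)
  ; cong      = λ { {i} refl → ≈-refl (p i) }
  ; bijective = distinct , λ { (X , i , eq) → i , λ { refl → eq } }
  }

module _ {X : Pred (Point n) 0ℓ} (size : HasSize (PG n) X k) where
  open Bijection size using (to; injective; strictlySurjective)

  element : Fin k → Point n
  element = proj₁ ∘ to

  element-∈ : ∀ i → element i ∈ X
  element-∈ = proj₂ ∘ to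

  element-distinct : Distinct element
  element-distinct = injective

  ⊆-⟦element⟧ : X ⊆ ⟦ element ⟧
  ⊆-⟦element⟧ {P} P∈X = strictlySurjective (P , P∈X)

size-resp-≐ : {X Y : Pred (Point n) 0ℓ} → X ≐ Y → HasSize (PG n) X k → HasSize (PG n) Y k
size-resp-≐ (X⊆Y , Y⊆X) size = record
  { to        = λ i → element size i , X⊆Y (element-∈ size i)
  ; cong      = λ { {i} refl → ≈-refl (element size i) }
  ; bijective = element-distinct size , λ (P , P∈Y) →
      let i , eq = ⊆-⟦element⟧ size (Y⊆X P∈Y) in i , λ { refl → eq }
  }

size-mono : {X Y : Pred (Point n) 0ℓ} → HasSize (PG n) X j → HasSize (PG n) Y k → X ⊆ Y → j ≤ k
size-mono X-size Y-size X⊆Y = injective⇒≤ {f = λ i → proj₁ (index i)} λ {a} {b} eq →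
  element-distinct X-size {a} {b}
    (≈-trans (element X-size a) (element Y-size (proj₁ (index b))) (element X-size b)
      (≈-sym (element Y-size (proj₁ (index b))) (element X-size a)
        (subst (λ i → element Y-size i ≈ element X-size a) eq (proj₂ (index a))))
      (proj₂ (index b)))
  where
  index : ∀ i → ∃ λ j → element Y-size j ≈ element X-size i
  index i = ⊆-⟦element⟧ Y-size (X⊆Y (element-∈ X-size i))

size-unique : {X : Pred (Point n) 0ℓ} → HasSize (PG n) X j → HasSize (PG n) X k → j ≡ k
size-unique size size′ = ℕ.≤-antisym (size-mono size size′ id) (size-mono size′ size id)

enumerate : (s : Subset n) → ∃ λ (f : Fin ∣ s ∣ → Fin n) →
            Injective _≡_ _≡_ f × (∀ j → lookup s (f j) ≡ true) ×
            (∀ i → lookup s i ≡ true → ∃ λ j → f j ≡ i)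
enumerate [] = (λ ()) , (λ { {()} }) , (λ ()) , λ ()
enumerate (true ∷ s) with f , inj , sound , complete ← enumerate s =
  f′ , (λ {x} {y} → inj′ x y) , sound′ , complete′
  where
  f′ : Fin (suc ∣ s ∣) → Fin _
  f′ zero    = zero
  f′ (suc j) = suc (f j)
  inj′ : ∀ x y → f′ x ≡ f′ y → x ≡ y
  inj′ zero    zero    _  = refl
  inj′ (suc x) (suc y) eq = cong suc (inj (suc-injective eq))
  sound′ : ∀ j → lookup (true ∷ s) (f′ j) ≡ true
  sound′ zero    = refl
  sound′ (suc j) = sound j
  complete′ : ∀ i → lookup (true ∷ s) i ≡ true → ∃ λ j → f′ j ≡ i
  complete′ zero    _  = zero , refl
  complete′ (suc i) eq = let j , fj≡i = complete i eq in suc j , cong suc fj≡i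
enumerate (false ∷ s) with f , inj , sound , complete ← enumerate s =
  suc ∘ f , inj ∘ suc-injective , sound ,
  λ { (suc i) eq → let j , fj≡i = complete i eq in j , cong suc fj≡i }

-- Enlarges `s` to exactly `k` places, so that a relation of weight at most `k` becomes one among
-- `k` vectors.
pad : (s : Subset n) → ∣ s ∣ ≤ k → k ≤ n → ∃ λ (f : Fin k → Fin n) →
      Injective _≡_ _≡_ f × (∀ i → lookup s i ≡ true → ∃ λ j → f j ≡ i)
pad [] _ z≤n = (λ ()) , (λ { {()} }) , λ ()
pad {n = suc n} {k = zero} (false ∷ s) le _ with f , inj , complete ← pad s le z≤n =
  suc ∘ f , inj ∘ suc-injective ,
  λ { (suc i) eq → let j , fj≡i = complete i eq in j , cong suc fj≡i }
pad {n = suc n} {k = suc k} (true ∷ s) (s≤s le) (s≤s k≤n) with f , inj , complete ← pad s le k≤n =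
  f′ , (λ {x} {y} → inj′ x y) ,
  λ { zero    _  → zero , refl
    ; (suc i) eq → let j , fj≡i = complete i eq in suc j , cong suc fj≡i }
  where
  f′ : Fin (suc k) → Fin (suc n)
  f′ zero    = zero
  f′ (suc j) = suc (f j)
  inj′ : ∀ x y → f′ x ≡ f′ y → x ≡ y
  inj′ zero    zero    _  = refl
  inj′ (suc x) (suc y) eq = cong suc (inj (suc-injective eq))
pad {n = suc n} {k = suc k} (false ∷ s) le k≤n with suc k ℕ.≤? n
... | yes k<n with f , inj , complete ← pad s le k<n =
  suc ∘ f , inj ∘ suc-injective ,
  λ { (suc i) eq → let j , fj≡i = complete i eq in j , cong suc fj≡i }
-- No place can be omitted any more, so all of them are listed.
... | no k≮n with refl ← ℕ.≤-antisym k≤n (ℕ.≰⇒> k≮n) = id , id , λ i _ → i , refl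

-- Reduces the size of a section to the cardinality of a Boolean vector, which can be computed.
selection-size : (p : Fin k → Point n) → Distinct p → {Q : Pred (Point n) 0ℓ} → Q Respects _≈_ →
                 (s : Subset k) → (∀ i → lookup s i ≡ true → p i ∈ Q) →
                 (∀ i → p i ∈ Q → lookup s i ≡ true) → HasSize (PG n) (Q ∩ ⟦ p ⟧) ∣ s ∣
selection-size p distinct {Q} resp s sound complete with f , inj , f-sound , f-complete ← enumerate s =
  size-resp-≐
    ( (λ { {P} (j , eq) → resp {p (f j)} {P} eq (sound (f j) (f-sound j)) , f j , eq })
    , (λ { {P} (P∈Q , i , eq) →
           let j , fj≡i = f-complete i (complete i (resp {P} {p i} (≈-sym (p i) P eq) P∈Q))
           in j , subst (λ i → p i ≈ P) (sym fj≡i) eq }))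
    (⟦⟧-size (p ∘ f) (inj ∘ distinct))

does-sound : {A : Set} (a? : Dec A) → does a? ≡ true → A
does-sound (yes a) _ = a

points-respects : ∀ {d} (H : Flat n d) → points H Respects _≈_
points-respects H (c , _ , refl) (cs , refl) =
  c ∙ cs , Linear.∙-homo (linComb-linear (Flat.basis H)) c cs

-- Hamming weight and short linear relations

support : Vector n → Subset n
support = map (λ a → does (¬? (a ≟ 0F)))

weight : Vector n → ℕ
weight v = ∣ support v ∣

weight-+ : (u v : Vector n) → weight (u +ᵥ v) ≤ weight u ℕ.+ weight v
weight-+ []       []       = z≤n
weight-+ (0F ∷ u) (0F ∷ v) = weight-+ u v
weight-+ (0F ∷ u) (1F ∷ v) = ℕ.≤-trans (s≤s (weight-+ u v)) (ℕ.≤-reflexive (sym (ℕ.+-suc (weight u) (weight v))))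
weight-+ (0F ∷ u) (2F ∷ v) = ℕ.≤-trans (s≤s (weight-+ u v)) (ℕ.≤-reflexive (sym (ℕ.+-suc (weight u) (weight v))))
weight-+ (1F ∷ u) (0F ∷ v) = s≤s (weight-+ u v)
weight-+ (2F ∷ u) (0F ∷ v) = s≤s (weight-+ u v)
weight-+ (1F ∷ u) (1F ∷ v) = s≤s (ℕ.≤-trans (weight-+ u v) (ℕ.+-monoʳ-≤ (weight u) (ℕ.n≤1+n _)))
weight-+ (2F ∷ u) (2F ∷ v) = s≤s (ℕ.≤-trans (weight-+ u v) (ℕ.+-monoʳ-≤ (weight u) (ℕ.n≤1+n _)))
weight-+ (1F ∷ u) (2F ∷ v) = ℕ.m≤n⇒m≤1+n (ℕ.≤-trans (weight-+ u v) (ℕ.+-monoʳ-≤ (weight u) (ℕ.n≤1+n _)))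
weight-+ (2F ∷ u) (1F ∷ v) = ℕ.m≤n⇒m≤1+n (ℕ.≤-trans (weight-+ u v) (ℕ.+-monoʳ-≤ (weight u) (ℕ.n≤1+n _)))

weight-∙ : ∀ c (v : Vector n) → weight (c ∙ v) ≤ weight v
weight-∙ c  []       = z≤n
weight-∙ 0F (0F ∷ v) = weight-∙ 0F v
weight-∙ 0F (1F ∷ v) = ℕ.m≤n⇒m≤1+n (weight-∙ 0F v)
weight-∙ 0F (2F ∷ v) = ℕ.m≤n⇒m≤1+n (weight-∙ 0F v)
weight-∙ 1F (0F ∷ v) = weight-∙ 1F v
weight-∙ 1F (1F ∷ v) = s≤s (weight-∙ 1F v)
weight-∙ 1F (2F ∷ v) = s≤s (weight-∙ 1F v)
weight-∙ 2F (0F ∷ v) = weight-∙ 2F v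
weight-∙ 2F (1F ∷ v) = s≤s (weight-∙ 2F v)
weight-∙ 2F (2F ∷ v) = s≤s (weight-∙ 2F v)

weight-0 : ∀ n → weight (0ᵥ {n}) ≡ 0
weight-0 zero    = refl
weight-0 (suc n) = weight-0 n

weight-unit : (i : Fin n) → weight (unit i) ≡ 1
weight-unit {suc n} zero = cong suc (weight-0 n)
weight-unit (suc i)      = weight-unit i

weight-∙unit : ∀ c (i : Fin n) → weight (c ∙ unit i) ≤ 1
weight-∙unit c i = ℕ.≤-trans (weight-∙ c (unit i)) (ℕ.≤-reflexive (weight-unit i))

lookup-0 : (i : Fin n) → lookup 0ᵥ i ≡ 0F
lookup-0 i = lookup-replicate i 0F

lookup-unit-≡ : (i : Fin n) → lookup (unit i) i ≡ 1F
lookup-unit-≡ zero    = refl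
lookup-unit-≡ (suc i) = lookup-unit-≡ i

lookup-unit-≢ : (i j : Fin n) → i ≢ j → lookup (unit i) j ≡ 0F
lookup-unit-≢ zero    zero    i≢j = contradiction refl i≢j
lookup-unit-≢ zero    (suc j) i≢j = lookup-0 j
lookup-unit-≢ (suc i) zero    i≢j = refl
lookup-unit-≢ (suc i) (suc j) i≢j = lookup-unit-≢ i j (i≢j ∘ cong suc)

lookup-+ : (u v : Vector n) (i : Fin n) → lookup (u +ᵥ v) i ≡ lookup u i +F lookup v i
lookup-+ u v i = lookup-zipWith _+F_ i u v

lookup-∙ : ∀ c (v : Vector n) (i : Fin n) → lookup (c ∙ v) i ≡ c *F lookup v i
lookup-∙ c v i = lookup-map i (c *F_) v

vector-ext : {u v : Vector n} → (∀ i → lookup u i ≡ lookup v i) → u ≡ v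
vector-ext {u = u} {v} eq =
  trans (sym (tabulate∘lookup u)) (trans (tabulate-cong eq) (tabulate∘lookup v))

-- For injective `f` the entry `j` of `cs` moves to place `f j`, with zeros elsewhere. This turns a
-- relation of a subfamily into one of the whole family.
scatter : (Fin k → Fin n) → Vector k → Vector n
scatter f cs = linComb cs (tabulate (unit ∘ f))

weight-scatter : (f : Fin k → Fin n) (cs : Vector k) → weight (scatter f cs) ≤ weight cs
weight-scatter {n = n} f [] = ℕ.≤-reflexive (weight-0 n)
weight-scatter {n = n} f (c ∷ cs) = ℕ.≤-trans (weight-+ (c ∙ unit (f zero)) (scatter (f ∘ suc) cs)) (bound c)
  where
  bound : ∀ c → weight (c ∙ unit (f zero)) ℕ.+ weight (scatter (f ∘ suc) cs) ≤ weight (c ∷ cs)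
  bound 0F = ℕ.+-mono-≤ (ℕ.≤-reflexive (trans (cong weight (∙-zeroˡ (unit (f zero)))) (weight-0 n)))
                        (weight-scatter (f ∘ suc) cs)
  bound 1F = ℕ.+-mono-≤ (weight-∙unit 1F (f zero)) (weight-scatter (f ∘ suc) cs)
  bound 2F = ℕ.+-mono-≤ (weight-∙unit 2F (f zero)) (weight-scatter (f ∘ suc) cs)

lookup-scatter-∉ : (f : Fin k → Fin n) (cs : Vector k) (i : Fin n) → (∀ j → f j ≢ i) →
                   lookup (scatter f cs) i ≡ 0F
lookup-scatter-∉ f []       i i∉ = lookup-0 i
lookup-scatter-∉ f (c ∷ cs) i i∉ = begin
  lookup (c ∙ unit (f zero) +ᵥ scatter (f ∘ suc) cs) i
    ≡⟨ lookup-+ (c ∙ unit (f zero)) _ i ⟩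
  lookup (c ∙ unit (f zero)) i +F lookup (scatter (f ∘ suc) cs) i
    ≡⟨ cong₂ _+F_ (trans (lookup-∙ c (unit (f zero)) i) (cong (c *F_) (lookup-unit-≢ (f zero) i (i∉ zero))))
                  (lookup-scatter-∉ (f ∘ suc) cs i (i∉ ∘ suc)) ⟩
  c *F 0F +F 0F
    ≡⟨ cong (_+F 0F) (*F-comm c 0F) ⟩
  0F ∎
  where open ≡-Reasoning

lookup-scatter : (f : Fin k → Fin n) → Injective _≡_ _≡_ f → (cs : Vector k) (j : Fin k) →
                 lookup (scatter f cs) (f j) ≡ lookup cs j
lookup-scatter f inj (c ∷ cs) zero = begin
  lookup (c ∙ unit (f zero) +ᵥ scatter (f ∘ suc) cs) (f zero)
    ≡⟨ lookup-+ (c ∙ unit (f zero)) _ (f zero) ⟩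
  lookup (c ∙ unit (f zero)) (f zero) +F lookup (scatter (f ∘ suc) cs) (f zero)
    ≡⟨ cong₂ _+F_ (trans (lookup-∙ c (unit (f zero)) (f zero)) (cong (c *F_) (lookup-unit-≡ (f zero))))
                  (lookup-scatter-∉ (f ∘ suc) cs (f zero) (λ j eq → contradiction (inj eq) λ ())) ⟩
  c *F 1F +F 0F
    ≡⟨ trans (+F-identityʳ (c *F 1F)) (trans (*F-comm c 1F) (*F-identityˡ c)) ⟩
  c ∎
  where open ≡-Reasoning
lookup-scatter f inj (c ∷ cs) (suc j) = begin
  lookup (c ∙ unit (f zero) +ᵥ scatter (f ∘ suc) cs) (f (suc j))
    ≡⟨ lookup-+ (c ∙ unit (f zero)) _ (f (suc j)) ⟩
  lookup (c ∙ unit (f zero)) (f (suc j)) +F lookup (scatter (f ∘ suc) cs) (f (suc j))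
    ≡⟨ cong₂ _+F_ (trans (lookup-∙ c (unit (f zero)) (f (suc j)))
                     (cong (c *F_) (lookup-unit-≢ (f zero) (f (suc j)) (λ eq → contradiction (inj eq) λ ()))))
                  (lookup-scatter (f ∘ suc) (suc-injective ∘ inj) cs j) ⟩
  c *F 0F +F lookup cs j
    ≡⟨ trans (cong (_+F lookup cs j) (*F-comm c 0F)) (+F-identityˡ (lookup cs j)) ⟩
  lookup cs j ∎
  where open ≡-Reasoning

linComb-scatter : (f : Fin k → Fin m) (cs : Vector k) (vs : Vec (Vector n) m) →
                  linComb (scatter f cs) vs ≡ linComb cs (tabulate (lookup vs ∘ f))
linComb-scatter f cs vs = begin
  linComb (linComb cs (tabulate (unit ∘ f))) vs
    ≡⟨ linComb-∘ cs (tabulate (unit ∘ f)) vs ⟩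
  linComb cs (map (λ u → linComb u vs) (tabulate (unit ∘ f)))
    ≡⟨ cong (linComb cs) (sym (tabulate-∘ (λ u → linComb u vs) (unit ∘ f))) ⟩
  linComb cs (tabulate (λ j → linComb (unit (f j)) vs))
    ≡⟨ cong (linComb cs) (tabulate-cong (λ j → linComb-unit (f j) vs)) ⟩
  linComb cs (tabulate (lookup vs ∘ f)) ∎
  where open ≡-Reasoning

linComb-++ : (a : Vector j) (b : Vector k) (us : Vec (Vector n) j) (ws : Vec (Vector n) k) →
             linComb (a ++ b) (us ++ ws) ≡ linComb a us +ᵥ linComb b ws
linComb-++ []      b []       ws = sym (+ᵥ-identityˡ (linComb b ws))
linComb-++ (c ∷ a) b (u ∷ us) ws =
  trans (cong (c ∙ u +ᵥ_) (linComb-++ a b us ws))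
        (sym (zipWith-assoc +F-assoc (c ∙ u) (linComb a us) (linComb b ws)))

-- For d ≤ k this says that any d of the vectors are linearly independent.
ShortRelationsTrivial : ℕ → Vec (Vector n) k → Set
ShortRelationsTrivial d vs = ∀ c → linComb c vs ≡ 0ᵥ → weight c ≤ d → c ≡ 0ᵥ

module ShortRelations {d} {vs : Vec (Vector n) k} (trivial : ShortRelationsTrivial d vs) where

  -- Scattering a relation of the subfamily gives a relation of all vectors with weight at most `d`.
  subfamily-independent : (f : Fin d → Fin k) → Injective _≡_ _≡_ f →
                          LinearlyIndependent (tabulate (lookup vs ∘ f))
  subfamily-independent f inj cs eq = vector-ext λ i → begin
    lookup cs i                   ≡⟨ sym (lookup-scatter f inj cs i) ⟩
    lookup (scatter f cs) (f i)   ≡⟨ cong (λ c → lookup c (f i)) (trivial (scatter f cs)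
                                       (trans (linComb-scatter f cs vs) eq) (ℕ.≤-trans (weight-scatter f cs) (∣p∣≤n (support cs)))) ⟩
    lookup 0ᵥ (f i)               ≡⟨ trans (lookup-0 (f i)) (sym (lookup-0 i)) ⟩
    lookup 0ᵥ i                   ∎
    where open ≡-Reasoning

  nonzero : 1 ≤ d → ∀ i → lookup vs i ≢ 0ᵥ
  nonzero 1≤d i vᵢ≡0 = contradiction (trans (sym (lookup-unit-≡ i)) (trans
    (cong (λ c → lookup c i) (trivial (unit i) (trans (linComb-unit i vs) vᵢ≡0)
      (ℕ.≤-trans (ℕ.≤-reflexive (weight-unit i)) 1≤d))) (lookup-0 i))) λ ()

  -- For distinct places the equation would be a relation of weight at most two whose entry at `j`
  -- is `2F`.
  non-proportional : 2 ≤ d → ∀ i j c → c ∙ lookup vs i ≡ lookup vs j → i ≡ j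
  non-proportional 2≤d i j c eq with i ≟ j
  ... | yes i≡j = i≡j
  ... | no  i≢j = contradiction (begin
    2F
      ≡⟨ cong₂ _+F_ (trans (*F-comm 0F c) (cong (c *F_) (sym (lookup-unit-≢ i j i≢j))))
                    (cong (2F *F_) (sym (lookup-unit-≡ j))) ⟩
    c *F lookup (unit i) j +F 2F *F lookup (unit j) j
      ≡⟨ sym (trans (lookup-+ (c ∙ unit i) (2F ∙ unit j) j)
                    (cong₂ _+F_ (lookup-∙ c (unit i) j) (lookup-∙ 2F (unit j) j))) ⟩
    lookup rel j
      ≡⟨ cong (λ r → lookup r j) (trivial rel rel-0 (ℕ.≤-trans (ℕ.≤-trans
           (weight-+ (c ∙ unit i) (2F ∙ unit j)) (ℕ.+-mono-≤ (weight-∙unit c i) (weight-∙unit 2F j))) 2≤d)) ⟩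
    lookup 0ᵥ j
      ≡⟨ lookup-0 j ⟩
    0F ∎) λ ()
    where
    open ≡-Reasoning
    L = linComb-linear vs
    rel = c ∙ unit i +ᵥ 2F ∙ unit j
    rel-0 : linComb rel vs ≡ 0ᵥ
    rel-0 = begin
      linComb rel vs
        ≡⟨ +-homo L (c ∙ unit i) (2F ∙ unit j) ⟩
      linComb (c ∙ unit i) vs +ᵥ linComb (2F ∙ unit j) vs
        ≡⟨ cong₂ _+ᵥ_ (trans (∙-homo L c (unit i)) (cong (c ∙_) (linComb-unit i vs)))
                      (trans (∙-homo L 2F (unit j)) (cong (2F ∙_) (linComb-unit j vs))) ⟩
      c ∙ lookup vs i +ᵥ 2F ∙ lookup vs j
        ≡⟨ cong (λ u → u +ᵥ 2F ∙ lookup vs j) eq ⟩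
      lookup vs j +ᵥ 2F ∙ lookup vs j
        ≡⟨ +ᵥ-2∙-inverse (lookup vs j) ⟩
      0ᵥ ∎

-- Designs of hyperplane sections

points? : ∀ {d} (H : Flat n d) → Decidable (points H)
points? H (v , _) = inSpan? (Flat.basis H) v

flat : ∀ {d} (p : Fin (suc d) → Point n) → LinearlyIndependent (tabulate (proj₁ ∘ p)) → Flat n d
flat p ind = record { basis = tabulate (proj₁ ∘ p) ; independent = ind }

∈-flat : ∀ {d} (p : Fin (suc d) → Point n) ind → ⟦ p ⟧ ⊆ points (flat p ind)
∈-flat p ind {X} (i , eq) = points-respects (flat p ind) {p i} {X} eq
  (unit i , trans (linComb-unit i (tabulate (proj₁ ∘ p))) (lookup∘tabulate (proj₁ ∘ p) i))

-- The dimensions agree, so the `d + 1` independent points already form a basis of `H`.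
flat-⊆⇒≐ : ∀ {d} (p : Fin (suc d) → Point n) ind (H : Flat n d) →
           (∀ i → p i ∈ points H) → points H ≐ points (flat p ind)
flat-⊆⇒≐ p ind H p∈H =
  span-maximal (tabulate (proj₁ ∘ p)) (Flat.basis H) ind p∈H′ ,
  span-mono (tabulate (proj₁ ∘ p)) (Flat.basis H) p∈H′
  where
  p∈H′ : ∀ i → InSpan (Flat.basis H) (lookup (tabulate (proj₁ ∘ p)) i)
  p∈H′ i = subst (InSpan (Flat.basis H)) (sym (lookup∘tabulate (proj₁ ∘ p) i)) (p∈H i)

module _ (p : Fin 12 → Point 5) (distinct : Distinct p)
  (independent : ∀ (f : Fin 5 → Fin 12) → Injective _≡_ _≡_ f → LinearlyIndependent (tabulate (proj₁ ∘ p ∘ f)))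
  (sections : (H : Hyperplane 5) → ∃ λ k → HasSize (PG 5) (points H ∩ ⟦ p ⟧) k × (k ≤ 3 ⊎ k ≡ 6))
  (M : Pred (Point 5) 0ℓ) (M≐p : M ≐ ⟦ p ⟧) where

  section-size : (H : Hyperplane 5) → ∃ λ k → HasSize (PG 5) (points H ∩ M) k × (k ≤ 3 ⊎ k ≡ 6)
  section-size H with k , size , k≤3⊎k≡6 ← sections H =
    k , size-resp-≐ ( (λ { (P∈H , P∈p) → P∈H , proj₂ M≐p P∈p })
                    , (λ { (P∈H , P∈M) → P∈H , proj₁ M≐p P∈M })) size , k≤3⊎k≡6

  -- Five independent points span a hyperplane, and any hyperplane through them coincides with it:
  -- this gives the block and its uniqueness. A section of more than three points has exactly six by
  -- `sections`.
  isDesign : IsSteinerDesign (PG 5) 5 12 6 M (𝓑 M)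
  isDesign = record
    { respects    = λ {P} {Q} P≈Q P∈M → proj₂ M≐p (⟦⟧-respects p {P} {Q} P≈Q (proj₁ M≐p P∈M))
    ; points-size = size-resp-≐ (proj₂ M≐p , proj₁ M≐p) (⟦⟧-size p distinct)
    ; block-⊆     = λ { X (H , X≐ , _) P∈X → proj₂ (proj₁ X≐ P∈X) }
    ; block-size  = block-size
    ; block-through = block-through
    }
    where
    block-size : ∀ X → X ∈ 𝓑 M → HasSize (PG 5) X 6
    block-size X (H , (X⊆ , ⊆X) , k , k>3 , size) with section-size H
    ... | k′ , size′ , inj₁ k′≤3 =
      contradiction k′≤3 (ℕ.<⇒≱ (subst (3 <_) (size-unique size size′) k>3))
    ... | _ , size′ , inj₂ refl = size-resp-≐ (⊆X , X⊆) size′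

    block-through : ∀ T → T Respects _≈_ → T ⊆ M → HasSize (PG 5) T 5 →
      ∃ λ X → X ∈ 𝓑 M × T ⊆ X × (∀ Y → Y ∈ 𝓑 M → T ⊆ Y → Y ≐ X)
    block-through T T-resp T⊆M T-size =
      -- The section contains the five points of `T`, hence more than three, and so counts as a
      -- block.
      points H ∩ M , (H , (id , id) , proj₁ section , ℕ.<⇒≤ (size-mono T-size (proj₁ (proj₂ section)) T⊆X) , proj₁ (proj₂ section)) ,
      T⊆X , unique
      where
      t = element T-size
      index : ∀ i → ∃ λ j → p j ≈ t i
      index i = proj₁ M≐p (T⊆M (element-∈ T-size i))
      f : Fin 5 → Fin 12
      f = proj₁ ∘ index
      f-injective : Injective _≡_ _≡_ f
      f-injective {a} {b} eq = element-distinct T-size {a} {b}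
        (≈-trans (t a) (p (f b)) (t b)
          (≈-sym (p (f b)) (t a) (subst (λ i → p i ≈ t a) eq (proj₂ (index a))))
          (proj₂ (index b)))
      H : Hyperplane 5
      H = flat (p ∘ f) (independent f f-injective)
      T⊆p : T ⊆ ⟦ p ∘ f ⟧
      T⊆p {P} P∈T = let i , eq = ⊆-⟦element⟧ T-size P∈T in
        i , ≈-trans (p (f i)) (t i) P (proj₂ (index i)) eq
      p∈T : ∀ i → p (f i) ∈ T
      p∈T i = T-resp {t i} {p (f i)} (≈-sym (p (f i)) (t i) (proj₂ (index i))) (element-∈ T-size i)
      T⊆X : T ⊆ points H ∩ M
      T⊆X {P} P∈T = ∈-flat (p ∘ f) (independent f f-injective) {P} (T⊆p P∈T) , T⊆M P∈T
      section = section-size H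
      unique : ∀ Y → Y ∈ 𝓑 M → T ⊆ Y → Y ≐ points H ∩ M
      unique Y (H′ , (Y⊆ , ⊆Y) , _) T⊆Y =
        (λ {P} P∈Y → proj₁ H′≐H {P} (proj₁ (Y⊆ P∈Y)) , proj₂ (Y⊆ P∈Y)) ,
        (λ {P} (P∈H , P∈M) → ⊆Y (proj₂ H′≐H {P} P∈H , P∈M))
        where
        H′≐H = flat-⊆⇒≐ (p ∘ f) (independent f f-injective) H′ (λ i → proj₁ (Y⊆ (T⊆Y (p∈T i))))

-- The extended ternary Golay code

-- Bordered by ones stands the matrix of the pentagon 1, 2, 4, 5, 3: `1F` marks its edges and `2F`,
-- that is -1, its non-edges.
conference : Vec (Vector 6) 6
conference = (0F ∷ 1F ∷ 1F ∷ 1F ∷ 1F ∷ 1F ∷ [])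
          ∷ (1F ∷ 0F ∷ 1F ∷ 1F ∷ 2F ∷ 2F ∷ [])
          ∷ (1F ∷ 1F ∷ 0F ∷ 2F ∷ 1F ∷ 2F ∷ [])
          ∷ (1F ∷ 1F ∷ 2F ∷ 0F ∷ 2F ∷ 1F ∷ [])
          ∷ (1F ∷ 2F ∷ 1F ∷ 2F ∷ 0F ∷ 1F ∷ [])
          ∷ (1F ∷ 2F ∷ 2F ∷ 1F ∷ 1F ∷ 0F ∷ [])
          ∷ []

golay : Vec (Vector 6) 12
golay = basis 6 ++ conference

opaque
  golay-shortRelations : ShortRelationsTrivial 5 golay
  -- A relation a ++ b satisfies a = − conference b, so the vectors b ∈ F⁶ can be run through.
  golay-shortRelations c rel short with a , b , refl ← Vec.splitAt 6 c =
    cong₂ _++_ (trans a≡ (trans (cong (λ b → 2F ∙ linComb b conference) b≡0) refl)) b≡0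
    where
    check : ∀ b → weight (2F ∙ linComb b conference ++ b) ≤ 5 → b ≡ 0ᵥ
    check = from-yes (allᵥ? λ b → (weight (2F ∙ linComb b conference ++ b) ℕ.≤? 5) →-dec (b ≟ᵥ 0ᵥ))
    a≡ : a ≡ 2F ∙ linComb b conference
    a≡ = +ᵥ-2∙-cancel _ _ (trans (cong₂ _+ᵥ_ (sym (linComb-basis a)) (∙-involutive 2F (λ ()) _))
           (trans (sym (linComb-++ a b (basis 6) conference)) rel))
    b≡0 : b ≡ 0ᵥ
    b≡0 = check b (subst (λ a → weight (a ++ b) ≤ 5) a≡ short)

dot : Vector n → Vector n → F
dot []      []      = 0F
dot (a ∷ u) (b ∷ v) = a *F b +F dot u v

-- The zeros of the code word generated by `b`, whose entries are the products of `b` with the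
-- columns of the generator matrix.
zeroSet : Vector 6 → Subset 12
zeroSet b = tabulate (λ i → does (dot (lookup golay i) b ≟ 0F))

opaque
  -- Nonzero words of the extended ternary Golay code have weight 6, 9 or 12; all generating vectors
  -- `b` are tested.
  golay-sections : ∀ b → b ≢ 0ᵥ → ∣ zeroSet b ∣ ≤ 3 ⊎ ∣ zeroSet b ∣ ≡ 6
  golay-sections = from-yes (allᵥ? λ b →
    ¬? (b ≟ᵥ 0ᵥ) →-dec ((∣ zeroSet b ∣ ℕ.≤? 3) ⊎-dec (∣ zeroSet b ∣ ℕ.≟ 6)))

head-linComb : (cs : Vector k) (vs : Vec (Vector (suc n)) k) → head (linComb cs vs) ≡ dot cs (map head vs)
head-linComb []       []             = refl
head-linComb (c ∷ cs) ((a ∷ v) ∷ vs) with linComb cs vs | head-linComb cs vs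
... | b ∷ w | eq = cong (c *F a +F_) eq

-- A linear image of the twelve standard points. Both the set `𝓚` and every competing design will be
-- brought to this form.
golayPoint : Iso 6 → Fin 12 → Point 5
golayPoint L i = Iso.to L (lookup golay i) ,
  Iso.to-≢0 L (ShortRelations.nonzero golay-shortRelations (s≤s z≤n) i)

golayPoint-distinct : ∀ L → Distinct (golayPoint L)
golayPoint-distinct L {i} {j} (c , _ , eq) =
  ShortRelations.non-proportional golay-shortRelations (s≤s (s≤s z≤n)) i j c
    (Iso.to-injective L (trans (∙-homo (Iso.linear L) c (lookup golay i)) eq))

module _ (L : Iso 6) where
  open Iso L

  golayPoint-independent : (f : Fin 5 → Fin 12) → Injective _≡_ _≡_ f →
                           LinearlyIndependent (tabulate (proj₁ ∘ golayPoint L ∘ f))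
  golayPoint-independent f inj cs eq =
    ShortRelations.subfamily-independent golay-shortRelations f inj cs (to-injective (begin
      to (linComb cs (tabulate (lookup golay ∘ f)))
        ≡⟨ linComb-homo linear cs _ ⟩
      linComb cs (map to (tabulate (lookup golay ∘ f)))
        ≡⟨ cong (linComb cs) (sym (tabulate-∘ to (lookup golay ∘ f))) ⟩
      linComb cs (tabulate (proj₁ ∘ golayPoint L ∘ f))
        ≡⟨ eq ⟩
      0ᵥ
        ≡⟨ sym (0-homo linear) ⟩
      to 0ᵥ ∎))
    where open ≡-Reasoning

  -- In coordinates adapted to `H`, the first coordinate of the image of `x` is a linear functional
  -- of `x` that vanishes exactly when this image lies in `H`. Its values on the standard basis form
  -- `b`, so the section corresponds to the zeros of a code word.
  golayPoint-sections : (H : Hyperplane 5) →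
    ∃ λ k → HasSize (PG 5) (points H ∩ ⟦ golayPoint L ⟧) k × (k ≤ 3 ⊎ k ≡ 6)
  golayPoint-sections H = ∣ zeroSet b ∣ ,
    selection-size (golayPoint L) (λ {i} {j} → golayPoint-distinct L {i} {j})
      {Q = points H} (λ {P} {Q} → points-respects H {P} {Q}) (zeroSet b)
      (λ i eq → head≡0⇒inSpan (to (lookup golay i)) (trans (head-f (lookup golay i)) (does-sound (zero? i) (trans (sym (lookup-zeroSet i)) eq))))
      (λ i ∈H → trans (lookup-zeroSet i) (dec-true (zero? i) (trans (sym (head-f (lookup golay i))) (inSpan⇒head≡0 (to (lookup golay i)) ∈H)))) ,
    golay-sections b b≢0
    where
    open ≡-Reasoning
    open HyperplaneCoordinates (Flat.basis H) (Flat.independent H)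
    module G = Iso coordinates
    f : Vector 6 → Vector 6
    f = G.from ∘ to
    b : Vector 6
    b = map head (map f (basis 6))
    head-f : ∀ x → head (f x) ≡ dot x b
    head-f x = begin
      head (f x)                            ≡⟨ cong (head ∘ f) (sym (linComb-basis x)) ⟩
      head (f (linComb x (basis 6)))        ≡⟨ cong head (linComb-homo (∘-linear G.from-linear linear) x (basis 6)) ⟩
      head (linComb x (map f (basis 6)))    ≡⟨ head-linComb x (map f (basis 6)) ⟩
      dot x b                               ∎
    dot-0 : ∀ {n} (x : Vector n) → dot x 0ᵥ ≡ 0F
    dot-0 []      = refl
    dot-0 (a ∷ x) = trans (cong₂ _+F_ (*F-comm a 0F) (dot-0 x)) refl
    -- The functional takes the value 1 on the preimage of the first adapted basis vector.
    b≢0 : b ≢ 0ᵥ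
    b≢0 b≡0 = contradiction (begin
      1F                        ≡⟨ cong head (sym (G.from∘to (unit 0F))) ⟩
      head (G.from (G.to (unit 0F)))            ≡⟨ cong (head ∘ G.from) (sym (to∘from (G.to (unit 0F)))) ⟩
      head (f (from (G.to (unit 0F))))          ≡⟨ head-f (from (G.to (unit 0F))) ⟩
      dot (from (G.to (unit 0F))) b             ≡⟨ trans (cong (dot (from (G.to (unit 0F)))) b≡0) (dot-0 (from (G.to (unit 0F)))) ⟩
      0F                                        ∎) λ ()
    zero? : ∀ i → Dec (dot (lookup golay i) b ≡ 0F)
    zero? i = dot (lookup golay i) b ≟ 0F
    lookup-zeroSet : ∀ i → lookup (zeroSet b) i ≡ does (zero? i)
    lookup-zeroSet i = lookup∘tabulate (does ∘ zero?) i

  golay-isDesign : (M : Pred (Point 5) 0ℓ) → M ≐ ⟦ golayPoint L ⟧ → IsSteinerDesign (PG 5) 5 12 6 M (𝓑 M)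
  golay-isDesign = isDesign (golayPoint L) (λ {i} {j} → golayPoint-distinct L {i} {j})
    golayPoint-independent golayPoint-sections

-- The symmetric square of a linear map

infixl 7 _⊙_
-- The polar form of `veronese`: the difference between the image of `u +ᵥ v` and the sum of the
-- images of `u` and `v`.
_⊙_ : Vector 3 → Vector 3 → Vector 6
(u₀ ∷ u₁ ∷ u₂ ∷ []) ⊙ (v₀ ∷ v₁ ∷ v₂ ∷ []) =
  u₀ *F v₀ +F u₀ *F v₀ ∷ u₀ *F v₁ +F u₁ *F v₀ ∷ u₀ *F v₂ +F u₂ *F v₀ ∷
  u₁ *F v₁ +F u₁ *F v₁ ∷ u₁ *F v₂ +F u₂ *F v₁ ∷ u₂ *F v₂ +F u₂ *F v₂ ∷ []

-- The coefficients of the monomials x², xy, xz, y², yz, z² in the Veronese image of x a + y b + z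
-- c.
symSquare : Vec (Vector 3) 3 → Vec (Vector 6) 6
symSquare (a ∷ b ∷ c ∷ []) =
  veronese a ∷ a ⊙ b ∷ a ⊙ c ∷ veronese b ∷ b ⊙ c ∷ veronese c ∷ []

opaque
  *F-interchange₄ : ∀ x y a b → (x *F y) *F (a *F b) ≡ (x *F a) *F (y *F b)
  *F-interchange₄ = from-yes (all? λ x → all? λ y → all? λ a → all? λ b →
    (x *F y) *F (a *F b) ≟ (x *F a) *F (y *F b))

polarise : ∀ x y a b c d →
           (x *F y) *F (a *F b +F c *F d) ≡ (x *F a) *F (y *F b) +F (x *F c) *F (y *F d)
polarise x y a b c d = trans (*F-distribˡ (x *F y) (a *F b) (c *F d))
  (cong₂ _+F_ (*F-interchange₄ x y a b) (*F-interchange₄ x y c d))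

opaque
  expand-product : ∀ u v w u′ v′ w′ →
    u *F u′ +F ((u *F v′ +F u′ *F v) +F ((u *F w′ +F u′ *F w) +F
      (v *F v′ +F ((v *F w′ +F v′ *F w) +F (w *F w′ +F 0F))))) ≡
    (u +F (v +F (w +F 0F))) *F (u′ +F (v′ +F (w′ +F 0F)))
  expand-product = from-yes (all? λ u → all? λ v → all? λ w → all? λ u′ → all? λ v′ → all? λ w′ →
    u *F u′ +F ((u *F v′ +F u′ *F v) +F ((u *F w′ +F u′ *F w) +F
      (v *F v′ +F ((v *F w′ +F v′ *F w) +F (w *F w′ +F 0F))))) ≟
    (u +F (v +F (w +F 0F))) *F (u′ +F (v′ +F (w′ +F 0F))))

-- Each coordinate on the right is a product of two linear forms in x, y, z. Expanding such a
-- product once, in `coordinate`, settles all six.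
symSquare-veronese : ∀ bs x → linComb (veronese x) (symSquare bs) ≡ veronese (linComb x bs)
symSquare-veronese
  ((a₀ ∷ a₁ ∷ a₂ ∷ []) ∷ (b₀ ∷ b₁ ∷ b₂ ∷ []) ∷ (c₀ ∷ c₁ ∷ c₂ ∷ []) ∷ []) (x ∷ y ∷ z ∷ []) =
  cong₂ _∷_ (coordinate a₀ b₀ c₀ a₀ b₀ c₀) (cong₂ _∷_ (coordinate a₀ b₀ c₀ a₁ b₁ c₁)
  (cong₂ _∷_ (coordinate a₀ b₀ c₀ a₂ b₂ c₂) (cong₂ _∷_ (coordinate a₁ b₁ c₁ a₁ b₁ c₁)
  (cong₂ _∷_ (coordinate a₁ b₁ c₁ a₂ b₂ c₂) (cong (_∷ []) (coordinate a₂ b₂ c₂ a₂ b₂ c₂))))))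
  where
  coordinate : ∀ a b c a′ b′ c′ →
    (x *F x) *F (a *F a′) +F ((x *F y) *F (a *F b′ +F a′ *F b) +F ((x *F z) *F (a *F c′ +F a′ *F c) +F
      ((y *F y) *F (b *F b′) +F ((y *F z) *F (b *F c′ +F b′ *F c) +F ((z *F z) *F (c *F c′) +F 0F))))) ≡
    (x *F a +F (y *F b +F (z *F c +F 0F))) *F (x *F a′ +F (y *F b′ +F (z *F c′ +F 0F)))
  coordinate a b c a′ b′ c′ = trans
    (cong₂ _+F_ (*F-interchange₄ x x a a′) (cong₂ _+F_ (polarise x y a b′ a′ b)
      (cong₂ _+F_ (polarise x z a c′ a′ c) (cong₂ _+F_ (*F-interchange₄ y y b b′)
        (cong₂ _+F_ (polarise y z b c′ b′ c) (cong (_+F 0F) (*F-interchange₄ z z c c′)))))))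
    (expand-product (x *F a) (y *F b) (z *F c) (x *F a′) (y *F b′) (z *F c′))

-- No nonzero quadratic form vanishes at all six of these vectors, which is why their Veronese
-- images are independent.
veroneseBasis : Vec (Vector 3) 6
veroneseBasis = (1F ∷ 0F ∷ 0F ∷ []) ∷ (1F ∷ 1F ∷ 0F ∷ []) ∷ (1F ∷ 0F ∷ 1F ∷ [])
              ∷ (0F ∷ 1F ∷ 0F ∷ []) ∷ (0F ∷ 1F ∷ 1F ∷ []) ∷ (0F ∷ 0F ∷ 1F ∷ []) ∷ []

opaque
  veroneseBasis-independent : LinearlyIndependent (map veronese veroneseBasis)
  veroneseBasis-independent = from-yes (allᵥ? λ cs →
    (linComb cs (map veronese veroneseBasis) ≟ᵥ 0ᵥ) →-dec (cs ≟ᵥ 0ᵥ))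

induced : (Vector 3 → Vector 3) → Vector 6 → Vector 6
induced f v = linComb v (symSquare (map f (basis 3)))

induced-linear : ∀ f → Linear (induced f)
induced-linear f = linComb-linear (symSquare (map f (basis 3)))

induced-veronese : ∀ {f} → Linear f → ∀ x → induced f (veronese x) ≡ veronese (f x)
induced-veronese {f} f-linear x = trans (symSquare-veronese (map f (basis 3)) x)
  (cong veronese (trans (sym (linComb-homo f-linear x (basis 3))) (cong f (linComb-basis x))))

-- The points of the Veronese surface span the whole space.
Linear-ext-veronese : {f g : Vector 6 → Vector 6} → Linear f → Linear g →
                      (∀ x → f (veronese x) ≡ g (veronese x)) → ∀ v → f v ≡ g v
Linear-ext-veronese {f} {g} f-linear g-linear eq v = begin
  f v
    ≡⟨ cong f (sym (to∘from v)) ⟩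
  f (linComb (from v) (map veronese veroneseBasis))
    ≡⟨ linComb-homo f-linear (from v) (map veronese veroneseBasis) ⟩
  linComb (from v) (map f (map veronese veroneseBasis))
    ≡⟨ cong (linComb (from v)) (trans (sym (map-∘ f veronese veroneseBasis))
         (trans (map-cong eq veroneseBasis) (map-∘ g veronese veroneseBasis))) ⟩
  linComb (from v) (map g (map veronese veroneseBasis))
    ≡⟨ sym (linComb-homo g-linear (from v) (map veronese veroneseBasis)) ⟩
  g (linComb (from v) (map veronese veroneseBasis))
    ≡⟨ cong g (to∘from v) ⟩
  g v ∎
  where
  open ≡-Reasoning
  open Iso (independent⇒iso (map veronese veroneseBasis) veroneseBasis-independent) using (from; to∘from)

id-linear : Linear {n} id
id-linear = record { +-homo = λ _ _ → refl ; ∙-homo = λ _ _ → refl }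

-- Both sides are linear, so they need comparing only on Veronese vectors, where `induced` acts
-- through the given map.
induced-inverse : (g : Iso 3) → ∀ v → induced (Iso.from g) (induced (Iso.to g) v) ≡ v
induced-inverse g = Linear-ext-veronese
  (∘-linear (induced-linear from) (induced-linear to)) id-linear λ x → begin
    induced from (induced to (veronese x))  ≡⟨ cong (induced from) (induced-veronese linear x) ⟩
    induced from (veronese (to x))          ≡⟨ induced-veronese from-linear (to x) ⟩
    veronese (from (to x))                  ≡⟨ cong veronese (from∘to x) ⟩
    veronese x                              ∎
  where
  open ≡-Reasoning
  open Iso g

opaque
  symSquare-iso : Iso 3 → Iso 6
  symSquare-iso g = iso (induced (Iso.to g)) (induced-linear (Iso.to g)) λ v eq →
    trans (sym (induced-inverse g v))
          (trans (cong (induced (Iso.from g)) eq) (0-homo (induced-linear (Iso.from g))))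

  symSquare-iso-veronese : ∀ g x → Iso.to (symSquare-iso g) (veronese x) ≡ veronese (Iso.to g x)
  symSquare-iso-veronese g = induced-veronese (Iso.linear g)

-- The model for the line x₀ = 0

-- Six points of the model, ordered and scaled so that the other six have the columns of
-- the conference matrix as their coordinates.
modelBasis : Vec (Vector 6) 6
modelBasis = (1F ∷ 0F ∷ 0F ∷ 0F ∷ 0F ∷ 0F ∷ [])
           ∷ (2F ∷ 0F ∷ 2F ∷ 0F ∷ 0F ∷ 2F ∷ [])
           ∷ (2F ∷ 0F ∷ 1F ∷ 0F ∷ 0F ∷ 2F ∷ [])
           ∷ (2F ∷ 2F ∷ 0F ∷ 2F ∷ 0F ∷ 0F ∷ [])
           ∷ (2F ∷ 2F ∷ 2F ∷ 2F ∷ 2F ∷ 2F ∷ [])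
           ∷ (1F ∷ 2F ∷ 1F ∷ 1F ∷ 2F ∷ 1F ∷ [])
           ∷ []

opaque
  modelBasis-independent : LinearlyIndependent modelBasis
  modelBasis-independent = from-yes (allᵥ? λ cs → (linComb cs modelBasis ≟ᵥ 0ᵥ) →-dec (cs ≟ᵥ 0ᵥ))

model : Iso 6
model = independent⇒iso modelBasis modelBasis-independent

modelPoint : Fin 12 → Vector 6
modelPoint i = linComb (lookup golay i) modelBasis

-- Representatives of the four points of the line x₀ = 0, with the first coordinate left out.
conic : Fin 4 → Vector 2
conic 0F = 1F ∷ 0F ∷ []
conic 1F = 0F ∷ 1F ∷ []
conic 2F = 1F ∷ 1F ∷ []
conic 3F = 1F ∷ 2F ∷ []

conicPoint : Fin 4 → Vector 6
conicPoint k = veronese (0F ∷ conic k)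

opaque
  -- Equality of vectors, not only of points, because `s` and its negative have the same quadratic
  -- image.
  conic-complete : ∀ s → s ≢ 0ᵥ → ∃ λ k → veronese (0F ∷ s) ≡ conicPoint k
  conic-complete = from-yes (allᵥ? λ s → ¬? (s ≟ᵥ 0ᵥ) →-dec any? λ k → veronese (0F ∷ s) ≟ᵥ conicPoint k)

  conicPoint-distinct : ∀ a b → conicPoint a ∼ conicPoint b → a ≡ b
  conicPoint-distinct = from-yes (all? λ a → all? λ b → (conicPoint a ∼? conicPoint b) →-dec (a ≟ b))

  affine-∈model : ∀ x → head x ≢ 0F → ∃ λ i → modelPoint i ∼ veronese x
  affine-∈model = from-yes (allᵥ? λ x → ¬? (head x ≟ 0F) →-dec any? λ i → modelPoint i ∼? veronese x)

chord : Fin 4 → Fin 4 → F → F → Vector 6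
chord a b α β = linComb (α ∷ β ∷ []) (conicPoint a ∷ conicPoint b ∷ [])

opaque
  diagonal-∈model : ∀ a b c d → a ≢ b → a ≢ c → a ≢ d → b ≢ c → b ≢ d → c ≢ d →
    ∀ α β γ δ → chord a b α β ≡ chord c d γ δ → chord a b α β ≢ 0ᵥ →
    ∃ λ i → modelPoint i ∼ chord a b α β
  diagonal-∈model = from-yes (all? λ a → all? λ b → all? λ c → all? λ d →
    ¬? (a ≟ b) →-dec ¬? (a ≟ c) →-dec ¬? (a ≟ d) →-dec ¬? (b ≟ c) →-dec ¬? (b ≟ d) →-dec ¬? (c ≟ d) →-dec
    all? λ α → all? λ β → all? λ γ → all? λ δ →
    (chord a b α β ≟ᵥ chord c d γ δ) →-dec ¬? (chord a b α β ≟ᵥ 0ᵥ) →-dec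
    any? λ i → modelPoint i ∼? chord a b α β)

  -- Nine of the twelve points are Veronese points off the line, and the other three are the
  -- diagonal points; this is the converse of the two inclusions above.
  model-affine⊎diagonal : ∀ i →
    (∃ λ x → head x ≢ 0F × veronese x ∼ modelPoint i) ⊎
    (∃ λ a → ∃ λ b → ∃ λ α → ∃ λ β → chord a b α β ≡ modelPoint i ×
     ∃ λ c → ∃ λ d → ∃ λ γ → ∃ λ δ → chord c d γ δ ≡ modelPoint i ×
     a ≢ b × a ≢ c × a ≢ d × b ≢ c × b ≢ d × c ≢ d)
  model-affine⊎diagonal = from-yes (all? λ i →
    (anyᵥ? λ x → ¬? (head x ≟ 0F) ×-dec (veronese x ∼? modelPoint i)) ⊎-dec
    (any? λ a → any? λ b → any? λ α → any? λ β → (chord a b α β ≟ᵥ modelPoint i) ×-dec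
     any? λ c → any? λ d → any? λ γ → any? λ δ → (chord c d γ δ ≟ᵥ modelPoint i) ×-dec
     ¬? (a ≟ b) ×-dec ¬? (a ≟ c) ×-dec ¬? (a ≟ d) ×-dec ¬? (b ≟ c) ×-dec ¬? (b ≟ d) ×-dec ¬? (c ≟ d)))

head-veronese≢0 : ∀ x → head x ≢ 0F → head (veronese x) ≢ 0F
head-veronese≢0 (x₀ ∷ _ ∷ _ ∷ []) x₀≢0 = *F-nonzero x₀ x₀ x₀≢0 x₀≢0

head-∙ : ∀ c (v : Vector (suc n)) → head (c ∙ v) ≡ c *F head v
head-∙ c (a ∷ v) = refl

-- Transport of the model to an arbitrary line

module _ (l∞ : Line 2) where

  open HyperplaneCoordinates (Flat.basis l∞) (Flat.independent l∞)
  private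
    module g = Iso coordinates
    S : Iso 6
    S = symSquare-iso coordinates
    module S = Iso S

    S-veronese : ∀ x → S.to (veronese x) ≡ veronese (g.to x)
    S-veronese = symSquare-iso-veronese coordinates

    S-∙ : ∀ c u {v} → c ∙ u ≡ v → c ∙ S.to u ≡ S.to v
    S-∙ c u eq = trans (sym (∙-homo S.linear c u)) (cong S.to eq)

    S-chord : ∀ a b α β →
      S.to (chord a b α β) ≡ linComb (α ∷ β ∷ []) (S.to (conicPoint a) ∷ S.to (conicPoint b) ∷ [])
    S-chord a b α β = linComb-homo S.linear (α ∷ β ∷ []) (conicPoint a ∷ conicPoint b ∷ [])

  -- The adapted coordinates carry x₀ = 0 to `l∞`, hence their symmetric square carries the model
  -- for the former to that for the latter.
  modelOf : Iso 6
  modelOf = S ∘-iso model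

  private
    conic≢0 : ∀ k → 0F ∷ conic k ≢ 0ᵥ
    conic≢0 = from-yes (all? λ k → ¬? (0F ∷ conic k ≟ᵥ 0ᵥ))

    linePoint : Fin 4 → Point 2
    linePoint k = g.to (0F ∷ conic k) , g.to-≢0 (conic≢0 k)

    Γ∞-point : Fin 4 → Point 5
    Γ∞-point k = S.to (conicPoint k) , S.to-≢0 (veronese-nonzero (0F ∷ conic k) (conic≢0 k))

    Γ∞-point-distinct : ∀ {a b} → Γ∞-point a ≈ Γ∞-point b → a ≡ b
    Γ∞-point-distinct {a} {b} (c , c≢0 , eq) = conicPoint-distinct a b
      (c , c≢0 , S.to-injective (trans (∙-homo S.linear c (conicPoint a)) eq))

    Γ∞-point-∈ : ∀ k → Γ∞-point k ∈ Γ∞ l∞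
    Γ∞-point-∈ k = linePoint k , (conic k , sym (to-0F∷ (conic k))) ,
      1F , (λ ()) , trans (∙-identity (veronese (g.to (0F ∷ conic k)))) (sym (S-veronese (0F ∷ conic k)))

    Γ∞-complete : ∀ A → A ∈ Γ∞ l∞ → ∃ λ k → Γ∞-point k ≈ A
    Γ∞-complete A ((P , P≢0) , (s , refl) , c , c≢0 , eq) with k , eq′ ← conic-complete s
      (λ { refl → P≢0 (0-homo (linComb-linear (Flat.basis l∞))) }) =
      k , c , c≢0 , (begin
        c ∙ S.to (conicPoint k)                          ≡⟨ cong (λ v → c ∙ S.to v) (sym eq′) ⟩
        c ∙ S.to (veronese (0F ∷ s))                     ≡⟨ cong (c ∙_) (S-veronese (0F ∷ s)) ⟩
        c ∙ veronese (g.to (0F ∷ s))                     ≡⟨ cong (λ v → c ∙ veronese v) (to-0F∷ s) ⟩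
        c ∙ veronese (linComb s (Flat.basis l∞))         ≡⟨ eq ⟩
        proj₁ A                                          ∎)
      where open ≡-Reasoning

    golayPoint-≈ : ∀ i {v} → modelPoint i ∼ v → (X : Point 5) → S.to v ≡ proj₁ X → golayPoint modelOf i ≈ X
    golayPoint-≈ i (c , c≢0 , eq) X eq′ = c , c≢0 , trans (S-∙ c (modelPoint i) eq) eq′

    affine-⊆ : im-φ ∖ Γ∞ l∞ ⊆ ⟦ golayPoint modelOf ⟧
    affine-⊆ {Q} ((P , φP≈Q) , Q∉Γ) with head (g.from (proj₁ P)) ≟ 0F
    ... | yes head≡0 = contradiction (P , head≡0⇒inSpan (proj₁ P) head≡0 , φP≈Q) Q∉Γ
    ... | no  head≢0 with i , i∼ ← affine-∈model (g.from (proj₁ P)) head≢0 =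
      i , ≈-trans (golayPoint modelOf i) φ⟨ P ⟩ Q
            (golayPoint-≈ i i∼ φ⟨ P ⟩ (trans (S-veronese (g.from (proj₁ P))) (cong veronese (g.to∘from (proj₁ P)))))
            φP≈Q

    -- The representatives of `A` and `B` may differ from the standard ones by factors `c` and `d`,
    -- which are absorbed into the coefficients.
    join-chord : ∀ {a b} A B X → Γ∞-point a ≈ A → Γ∞-point b ≈ B → X ∈ join A B →
                 ∃ λ α → ∃ λ β → S.to (chord a b α β) ≡ proj₁ X
    join-chord {a} {b} (_ , _) (_ , _) (_ , _) (c , _ , refl) (d , _ , refl) (α ∷ β ∷ [] , refl) =
      α *F c , β *F d , trans (S-chord a b (α *F c) (β *F d))
        (cong₂ (λ u v → u +ᵥ (v +ᵥ 0ᵥ)) (∙-assoc α c (S.to (conicPoint a))) (∙-assoc β d (S.to (conicPoint b))))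

    ≢-index : ∀ {a b} A B → Γ∞-point a ≈ A → Γ∞-point b ≈ B → ¬ A ≈ B → a ≢ b
    ≢-index {a} A B a≈A b≈B A≉B refl =
      A≉B (≈-trans A (Γ∞-point a) B (≈-sym (Γ∞-point a) A a≈A) b≈B)

    diagonal-⊆ : Δ∞ l∞ ⊆ ⟦ golayPoint modelOf ⟧
    diagonal-⊆ {X} (A , B , C , D , (A∈ , B∈ , C∈ , D∈) , (A≉B , A≉C , A≉D , B≉C , B≉D , C≉D) , X∈AB , X∈CD)
      with a , a≈A ← Γ∞-complete A A∈ | b , b≈B ← Γ∞-complete B B∈
         | c , c≈C ← Γ∞-complete C C∈ | d , d≈D ← Γ∞-complete D D∈
      with α , β , eq ← join-chord {a} {b} A B X a≈A b≈B X∈AB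
         | γ , δ , eq′ ← join-chord {c} {d} C D X c≈C d≈D X∈CD
      with i , i∼ ← diagonal-∈model a b c d
             (≢-index A B a≈A b≈B A≉B) (≢-index A C a≈A c≈C A≉C) (≢-index A D a≈A d≈D A≉D)
             (≢-index B C b≈B c≈C B≉C) (≢-index B D b≈B d≈D B≉D) (≢-index C D c≈C d≈D C≉D)
             α β γ δ (S.to-injective (trans eq (sym eq′)))
             (λ z≡0 → proj₂ X (trans (sym eq) (trans (cong S.to z≡0) (0-homo S.linear)))) =
      i , golayPoint-≈ i i∼ X eq

    chord-join : ∀ a b α β {v} → chord a b α β ≡ v → ∀ e → (X : Point 5) → e ∙ S.to v ≡ proj₁ X →
                 X ∈ join (Γ∞-point a) (Γ∞-point b)
    chord-join a b α β refl e X eq = e ∙ (α ∷ β ∷ []) , trans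
      (∙-homo (linComb-linear (S.to (conicPoint a) ∷ S.to (conicPoint b) ∷ [])) e (α ∷ β ∷ []))
      (trans (cong (e ∙_) (sym (S-chord a b α β))) eq)

    ⊆-𝓚 : ⟦ golayPoint modelOf ⟧ ⊆ 𝓚 l∞
    ⊆-𝓚 {Q} (i , i≈Q@(e , _ , eq)) with model-affine⊎diagonal i
    ... | inj₁ (x , head≢0 , c , c≢0 , eq′) = inj₁ ((P , φP≈Q) , Q∉Γ)
      where
      P : Point 2
      P = g.to x , g.to-≢0 {x} (λ { refl → head≢0 refl })
      φP≈Q : φ⟨ P ⟩ ≈ Q
      φP≈Q = ≈-trans φ⟨ P ⟩ (golayPoint modelOf i) Q
        (c , c≢0 , trans (cong (c ∙_) (sym (S-veronese x))) (S-∙ c (veronese x) eq′)) i≈Q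
      -- The first coordinate of a Veronese vector is x₀²: it is nonzero for `x` but zero for every
      -- point of the line x₀ = 0.
      Q∉Γ : ¬ (Q ∈ Γ∞ l∞)
      Q∉Γ (P′@(_ , _) , (s@(_ ∷ _ ∷ []) , refl) , φP′≈Q)
        with d , d≢0 , eq″ ← ≈-trans φ⟨ P ⟩ Q φ⟨ P′ ⟩ φP≈Q (≈-sym φ⟨ P′ ⟩ Q φP′≈Q) =
        *F-nonzero d (head (veronese x)) d≢0 (head-veronese≢0 x head≢0)
          (trans (sym (head-∙ d (veronese x))) (cong head (S.to-injective (begin
            S.to (d ∙ veronese x)                    ≡⟨ ∙-homo S.linear d (veronese x) ⟩
            d ∙ S.to (veronese x)                    ≡⟨ cong (d ∙_) (S-veronese x) ⟩
            d ∙ veronese (g.to x)                    ≡⟨ eq″ ⟩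
            veronese (linComb s (Flat.basis l∞))     ≡⟨ cong veronese (sym (to-0F∷ s)) ⟩
            veronese (g.to (0F ∷ s))                 ≡⟨ sym (S-veronese (0F ∷ s)) ⟩
            S.to (veronese (0F ∷ s))                 ∎))))
        where open ≡-Reasoning
    ... | inj₂ (a , b , α , β , eq₁ , c , d , γ , δ , eq₂ , a≢b , a≢c , a≢d , b≢c , b≢d , c≢d) = inj₂
      ( Γ∞-point a , Γ∞-point b , Γ∞-point c , Γ∞-point d
      , (Γ∞-point-∈ a , Γ∞-point-∈ b , Γ∞-point-∈ c , Γ∞-point-∈ d)
      , (a≢b ∘ Γ∞-point-distinct , a≢c ∘ Γ∞-point-distinct , a≢d ∘ Γ∞-point-distinct
        , b≢c ∘ Γ∞-point-distinct , b≢d ∘ Γ∞-point-distinct , c≢d ∘ Γ∞-point-distinct)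
      , chord-join a b α β eq₁ e Q eq , chord-join c d γ δ eq₂ e Q eq )

  opaque
    𝓚-golay : ∃ λ (L : Iso 6) → 𝓚 l∞ ≐ ⟦ golayPoint L ⟧
    𝓚-golay = modelOf ,
      (λ { {X} (inj₁ X∈) → affine-⊆ {X} X∈ ; {X} (inj₂ X∈) → diagonal-⊆ {X} X∈ }) ,
      λ {X} → ⊆-𝓚 {X}

-- From independent subfamilies to relations of small weight

independent-tail : {w : Vector n} {vs : Vec (Vector n) k} →
                   LinearlyIndependent (w ∷ vs) → LinearlyIndependent vs
independent-tail {w = w} {vs} ind cs eq =
  proj₂ (∷-injective (ind (0F ∷ cs) (trans (linComb-0F∷ cs w vs) eq)))

support-complete : (c : Vector n) (i : Fin n) → lookup c i ≢ 0F → lookup (support c) i ≡ true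
support-complete c i cᵢ≢0 =
  trans (lookup-map i _ c) (dec-true (¬? (lookup c i ≟ 0F)) cᵢ≢0)

-- The support of a short relation is padded to `d` places. Outside them the relation vanishes, so
-- it restricts to a relation among `d` independent vectors.
independent⇒shortRelations : ∀ {d} (vs : Vec (Vector n) k) → d ≤ k →
  (∀ (f : Fin d → Fin k) → Injective _≡_ _≡_ f → LinearlyIndependent (tabulate (lookup vs ∘ f))) →
  ShortRelationsTrivial d vs
independent⇒shortRelations vs d≤k ind c rel short
  with f , inj , complete ← pad (support c) short d≤k =
  trans (sym c≡) (trans (cong (scatter f) cs≡0) (0-homo (linComb-linear (tabulate (unit ∘ f)))))
  where
  cs = tabulate (lookup c ∘ f)
  c≡ : scatter f cs ≡ c
  c≡ = vector-ext λ i → pointwise i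
    where
    pointwise : ∀ i → lookup (scatter f cs) i ≡ lookup c i
    pointwise i with any? (λ j → f j ≟ i)
    ... | yes (j , refl) = trans (lookup-scatter f inj cs j) (lookup∘tabulate (lookup c ∘ f) j)
    ... | no  i∉ = trans (lookup-scatter-∉ f cs i (λ j eq → i∉ (j , eq)))
      (sym (decidable-stable (lookup c i ≟ 0F) (λ cᵢ≢0 → i∉ (complete i (support-complete c i cᵢ≢0)))))
  cs≡0 : cs ≡ 0ᵥ
  cs≡0 = ind f inj cs (trans (sym (linComb-scatter f cs vs)) (trans (cong (λ c → linComb c vs) c≡) rel))

-- Independence of the points of a design

module DesignFrame (K : Pred (Point 5) 0ℓ) (design : IsSteinerDesign (PG 5) 5 12 6 K (𝓑 K))
  (vs : Vec (Vector 6) 12) (nonzero : ∀ i → lookup vs i ≢ 0ᵥ) where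

  point : Fin 12 → Point 5
  point i = lookup vs i , nonzero i

  module _ (distinct : Distinct point) (K≐ : K ≐ ⟦ point ⟧) where

    open IsSteinerDesign design

    point-∈ : ∀ i → point i ∈ K
    point-∈ i = proj₂ K≐ (i , ≈-refl (point i))

    -- Membership of each of the twelve points in `H` is decidable; this yields the size that a
    -- block of `𝓑` has to carry.
    section-finite : (H : Hyperplane 5) → ∃ λ k → HasSize (PG 5) (points H ∩ K) k
    section-finite H = _ , size-resp-≐
      ((λ { (P∈H , P∈) → P∈H , proj₂ K≐ P∈ }) , (λ { (P∈H , P∈K) → P∈H , proj₁ K≐ P∈K }))
      (selection-size point distinct {points H} (λ {P} {Q} → points-respects H {P} {Q})
        (tabulate (does ∘ ∈H?))
        (λ i eq → does-sound (∈H? i) (trans (sym (lookup∘tabulate (does ∘ ∈H?) i)) eq))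
        (λ i ∈H → trans (lookup∘tabulate (does ∘ ∈H?) i) (dec-true (∈H? i) ∈H)))
      where
      ∈H? : ∀ i → Dec (point i ∈ points H)
      ∈H? i = points? H (point i)

    -- For the last component, a hyperplane `H′` through the five points meets `K` in more than
    -- three points. The section is therefore a block, and by uniqueness it is the one cut out by
    -- `H`.
    block-hyperplane : (f : Fin 5 → Fin 12) → Injective _≡_ _≡_ f → ∃ λ (H : Hyperplane 5) →
      (∀ i → point (f i) ∈ points H) × HasSize (PG 5) (points H ∩ K) 6 ×
      (∀ H′ → (∀ i → point (f i) ∈ points H′) → points H′ ∩ K ⊆ points H)
    block-hyperplane f inj
      with X , X∈𝓑@(H , (X⊆ , ⊆X) , _) , T⊆X , unique ← block-through ⟦ point ∘ f ⟧
             (λ {P} {Q} → ⟦⟧-respects (point ∘ f) {P} {Q})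
             (λ { {P} (i , eq) → respects {point (f i)} {P} eq (point-∈ (f i)) })
             (⟦⟧-size (point ∘ f) (inj ∘ distinct)) =
      H , (λ i → proj₁ (X⊆ (T⊆X {point (f i)} (i , ≈-refl (point (f i)))))) ,
      size-resp-≐ (X⊆ , ⊆X) (block-size X X∈𝓑) ,
      λ H′ f∈H′ {P} P∈ → proj₁ (X⊆ (proj₁ (unique (points H′ ∩ K)
        (H′ , (id , id) , proj₁ (section-finite H′) , ℕ.<⇒≤ (size-mono (⟦⟧-size (point ∘ f) (inj ∘ distinct))
          (proj₂ (section-finite H′)) (T⊆ H′ f∈H′)) , proj₂ (section-finite H′))
        (λ {P} → T⊆ H′ f∈H′ {P})) {P} P∈))
      where
      T⊆ : ∀ H′ → (∀ i → point (f i) ∈ points H′) → ⟦ point ∘ f ⟧ ⊆ points H′ ∩ K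
      T⊆ H′ f∈H′ {P} (i , eq) =
        points-respects H′ {point (f i)} {P} eq (f∈H′ i) , respects {point (f i)} {P} eq (point-∈ (f i))

    opaque
      -- If the six points were dependent, some hyperplane would contain all of them,
      -- and its block would differ from the one through the first five.
      sixth-point : (f : Fin 5 → Fin 12) → Injective _≡_ _≡_ f → ∃ λ m →
        LinearlyIndependent (lookup vs m ∷ tabulate (lookup vs ∘ f))
      sixth-point f inj with H , f∈H , size , maximal ← block-hyperplane f inj
        with any? (λ m → ¬? (points? H (point m)))
      -- The section by `H` has six points, so `H` cannot contain all twelve.
      ... | no none = contradiction (size-mono points-size size λ {P} P∈K →
              let i , eq = proj₁ K≐ P∈K in
              points-respects H {point i} {P} eq
                (decidable-stable (points? H (point i)) (λ i∉ → none (i , i∉))) , P∈K)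
              (ℕ.<⇒≱ (s≤s (s≤s (s≤s (s≤s (s≤s (s≤s (s≤s z≤n))))))))
      ... | yes (m , m∉H) with independent-or-redundant (lookup vs m ∷ tabulate (lookup vs ∘ f))
      ...   | inj₁ ind = m , ind
      ...   | inj₂ (r , s≤s r≤5 , us , us-ind , us⊇)
            with ws , ws-ind , us⊆ws ← extend (ℕ.≤⇒≤′ r≤5) (ℕ.n≤1+n 5) us us-ind =
            contradiction (maximal (record { basis = ws ; independent = ws-ind })
              (λ i → us⊆ws (subst (InSpan us) (lookup∘tabulate (lookup vs ∘ f) i) (us⊇ (suc i))))
              {point m} (us⊆ws (us⊇ zero) , point-∈ m)) m∉H

      five-independent : (f : Fin 5 → Fin 12) → Injective _≡_ _≡_ f →
                         LinearlyIndependent (tabulate (lookup vs ∘ f))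
      five-independent f inj = independent-tail (proj₂ (sixth-point f inj))

      -- The block through the five points has a sixth element, and its hyperplane is spanned by the
      -- five because they are independent.
      block-in-span : (f : Fin 5 → Fin 12) → Injective _≡_ _≡_ f → ∃ λ m →
        (∀ i → f i ≢ m) × InSpan (tabulate (lookup vs ∘ f)) (lookup vs m)
      block-in-span f inj with H , f∈H , size , _ ← block-hyperplane f inj
        with any? (λ m → all? (λ i → ¬? (f i ≟ m)) ×-dec points? H (point m))
      ... | yes (m , m∉f , m∈H) = m , m∉f ,
        proj₁ (flat-⊆⇒≐ (point ∘ f) (five-independent f inj) H f∈H) {point m} m∈H
      ... | no  none = contradiction (size-mono size (⟦⟧-size (point ∘ f) (inj ∘ distinct)) H∩K⊆) (ℕ.<-irrefl refl)
        where
        H∩K⊆ : points H ∩ K ⊆ ⟦ point ∘ f ⟧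
        H∩K⊆ {P} (P∈H , P∈K) with m , eq ← proj₁ K≐ P∈K with any? (λ i → f i ≟ m)
        ... | yes (i , refl) = i , eq
        ... | no  m∉f = contradiction
          (m , (λ i eq′ → m∉f (i , eq′)) , points-respects H {P} {point m} (≈-sym (point m) P eq) P∈H) none

      shortRelations : ShortRelationsTrivial 5 vs
      shortRelations = independent⇒shortRelations vs
        (s≤s (s≤s (s≤s (s≤s (s≤s z≤n))))) five-independent

-- Normal form of the Golay code

opaque
  weight≥5⇒zero-unique : ∀ (v : Vector 6) → 5 ≤ weight v → ∀ i j →
                         lookup v i ≡ 0F → lookup v j ≡ 0F → i ≡ j
  weight≥5⇒zero-unique = from-yes (allᵥ? λ (v : Vector 6) → (5 ℕ.≤? weight v) →-dec all? λ i → all? λ j →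
    (lookup v i ≟ 0F) →-dec (lookup v j ≟ 0F) →-dec (i ≟ j))

ZeroExactlyAt : Fin n → Vector n → Set
ZeroExactlyAt i v = ∀ j → (lookup v j ≡ 0F → i ≡ j) × (i ≡ j → lookup v j ≡ 0F)

zeroExactlyAt? : (i : Fin n) (v : Vector n) → Dec (ZeroExactlyAt i v)
zeroExactlyAt? i v = all? λ j → ((lookup v j ≟ 0F) →-dec (i ≟ j)) ×-dec ((i ≟ j) →-dec (lookup v j ≟ 0F))

Normalised : Fin 6 → Vector 6 → Set
Normalised i v = head v ≡ 1F × ZeroExactlyAt i v

normalised? : ∀ i v → Dec (Normalised i v)
normalised? i v = (head v ≟ 1F) ×-dec zeroExactlyAt? i v

-- Up to sign, sum and difference are the only combinations with both coefficients nonzero; each may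
-- have at most two zeros.
Compatible : Vector 6 → Vector 6 → Set
Compatible u v = 4 ≤ weight (u +ᵥ v) × 4 ≤ weight (u +ᵥ 2F ∙ v)

compatible? : ∀ u v → Dec (Compatible u v)
compatible? u v = (4 ℕ.≤? weight (u +ᵥ v)) ×-dec (4 ℕ.≤? weight (u +ᵥ 2F ∙ v))

-- Deleting the first row and column of a normalised matrix leaves the ±1 adjacency matrix
-- of a pentagon on five labelled vertices.  These relabellings carry the pentagon of the
-- conference matrix to each of the twelve possible ones.
relabelling : Fin 12 → Vec (Fin 6) 6
relabelling 0F  = 0F ∷ 1F ∷ 2F ∷ 3F ∷ 4F ∷ 5F ∷ []
relabelling 1F  = 0F ∷ 1F ∷ 2F ∷ 3F ∷ 5F ∷ 4F ∷ []
relabelling 2F  = 0F ∷ 1F ∷ 2F ∷ 4F ∷ 3F ∷ 5F ∷ []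
relabelling 3F  = 0F ∷ 1F ∷ 2F ∷ 5F ∷ 3F ∷ 4F ∷ []
relabelling 4F  = 0F ∷ 1F ∷ 2F ∷ 4F ∷ 5F ∷ 3F ∷ []
relabelling 5F  = 0F ∷ 1F ∷ 2F ∷ 5F ∷ 4F ∷ 3F ∷ []
relabelling 6F  = 0F ∷ 1F ∷ 4F ∷ 2F ∷ 3F ∷ 5F ∷ []
relabelling 7F  = 0F ∷ 1F ∷ 4F ∷ 3F ∷ 2F ∷ 5F ∷ []
relabelling 8F  = 0F ∷ 1F ∷ 4F ∷ 2F ∷ 5F ∷ 3F ∷ []
relabelling 9F  = 0F ∷ 1F ∷ 4F ∷ 3F ∷ 5F ∷ 2F ∷ []
relabelling (suc 9F)       = 0F ∷ 1F ∷ 4F ∷ 5F ∷ 2F ∷ 3F ∷ []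
relabelling (suc (suc 9F)) = 0F ∷ 1F ∷ 4F ∷ 5F ∷ 3F ∷ 2F ∷ []

permute : Vec (Fin n) m → Vector n → Vector m
permute ρ v = map (lookup v) ρ

permute-linear : (ρ : Vec (Fin n) m) → Linear (permute ρ)
permute-linear ρ = record { +-homo = λ u v → plus u v ρ ; ∙-homo = λ c v → scale c v ρ }
  where
  plus : (u v : Vector n) (ρ : Vec (Fin n) m) → permute ρ (u +ᵥ v) ≡ permute ρ u +ᵥ permute ρ v
  plus u v []      = refl
  plus u v (i ∷ ρ) = cong₂ _∷_ (lookup-+ u v i) (plus u v ρ)
  scale : ∀ c (v : Vector n) (ρ : Vec (Fin n) m) → permute ρ (c ∙ v) ≡ c ∙ permute ρ v
  scale c v []      = refl
  scale c v (i ∷ ρ) = cong₂ _∷_ (lookup-∙ c v i) (scale c v ρ)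

opaque
  relabelling-surjective : ∀ t i → ∃ λ j → lookup (relabelling t) j ≡ i
  relabelling-surjective = from-yes (all? λ t → all? λ i → any? λ j → lookup (relabelling t) j ≟ i)

  permute-unit : ∀ t i → ∃ λ j → permute (relabelling t) (unit i) ≡ unit j
  permute-unit = from-yes (all? λ t → all? λ i → any? λ j → permute (relabelling t) (unit i) ≟ᵥ unit j)

relabelling-iso : Fin 12 → Iso 6
relabelling-iso t = iso (permute (relabelling t)) (permute-linear (relabelling t)) λ v eq → vector-ext λ i →
  let j , ρj≡i = relabelling-surjective t i in
  trans (cong (lookup v) (sym ρj≡i)) (trans (sym (lookup-map j (lookup v) (relabelling t)))
    (trans (cong (λ u → lookup u j) eq) (trans (lookup-0 j) (sym (lookup-0 i)))))

firstColumn : Vector 6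
firstColumn = 0F ∷ 1F ∷ 1F ∷ 1F ∷ 1F ∷ 1F ∷ []

opaque
  -- A backtracking search: the conditions on a column are tested before the next one is chosen. The
  -- relabelling permutes coordinates, and `j` absorbs the accompanying change in the order of the
  -- columns.
  normalised⇒conference :
    ∀ v₁ → Normalised 1F v₁ → Compatible firstColumn v₁ →
    ∀ v₂ → Normalised 2F v₂ → Compatible firstColumn v₂ → Compatible v₁ v₂ →
    ∀ v₃ → Normalised 3F v₃ → Compatible firstColumn v₃ → Compatible v₁ v₃ → Compatible v₂ v₃ →
    ∀ v₄ → Normalised 4F v₄ → Compatible firstColumn v₄ → Compatible v₁ v₄ → Compatible v₂ v₄ → Compatible v₃ v₄ →
    ∀ v₅ → Normalised 5F v₅ → Compatible firstColumn v₅ → Compatible v₁ v₅ → Compatible v₂ v₅ → Compatible v₃ v₅ →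
    Compatible v₄ v₅ →
    ∃ λ t → ∀ i → ∃ λ j →
      permute (relabelling t) (lookup conference i) ≡ lookup (firstColumn ∷ v₁ ∷ v₂ ∷ v₃ ∷ v₄ ∷ v₅ ∷ []) j
  normalised⇒conference = from-yes (
    allᵥ? λ v₁ → normalised? 1F v₁ →-dec compatible? firstColumn v₁ →-dec
    allᵥ? λ v₂ → normalised? 2F v₂ →-dec compatible? firstColumn v₂ →-dec compatible? v₁ v₂ →-dec
    allᵥ? λ v₃ → normalised? 3F v₃ →-dec compatible? firstColumn v₃ →-dec compatible? v₁ v₃ →-dec compatible? v₂ v₃ →-dec
    allᵥ? λ v₄ → normalised? 4F v₄ →-dec compatible? firstColumn v₄ →-dec compatible? v₁ v₄ →-dec compatible? v₂ v₄ →-dec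
      compatible? v₃ v₄ →-dec
    allᵥ? λ v₅ → normalised? 5F v₅ →-dec compatible? firstColumn v₅ →-dec compatible? v₁ v₅ →-dec compatible? v₂ v₅ →-dec
      compatible? v₃ v₅ →-dec compatible? v₄ v₅ →-dec
    any? λ t → all? λ i → any? λ j →
      permute (relabelling t) (lookup conference i) ≟ᵥ lookup (firstColumn ∷ v₁ ∷ v₂ ∷ v₃ ∷ v₄ ∷ v₅ ∷ []) j)
  
opaque
  *F-leftComm : ∀ a b c → a *F (b *F c) ≡ b *F (a *F c)
  *F-leftComm = from-yes (all? λ a → all? λ b → all? λ c → a *F (b *F c) ≟ b *F (a *F c))

  normalise-first : ∀ v → ZeroExactlyAt 0F v → zipWith _*F_ (1F ∷ tail v) v ≡ firstColumn
  normalise-first = from-yes (allᵥ? λ v → zeroExactlyAt? 0F v →-dec (zipWith _*F_ (1F ∷ tail v) v ≟ᵥ firstColumn))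

  golay-unit⊎conference : ∀ i → (∃ λ j → lookup golay i ≡ unit j) ⊎ (∃ λ j → lookup golay i ≡ lookup conference j)
  golay-unit⊎conference = from-yes (all? λ i →
    (any? λ j → lookup golay i ≟ᵥ unit j) ⊎-dec (any? λ j → lookup golay i ≟ᵥ lookup conference j))

module Diagonal (d : Vector n) (d≢0 : ∀ i → lookup d i ≢ 0F) where

  diag : Vector n → Vector n
  diag = zipWith _*F_ d

  lookup-diag : ∀ v i → lookup (diag v) i ≡ lookup d i *F lookup v i
  lookup-diag v i = lookup-zipWith _*F_ i d v

  diag-linear : Linear diag
  diag-linear = record
    { +-homo = zipWith-distribˡ *F-distribˡ d
    ; ∙-homo = λ c v → vector-ext λ i → trans (lookup-diag (c ∙ v) i)
        (trans (cong (lookup d i *F_) (lookup-∙ c v i))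
        (trans (*F-leftComm (lookup d i) c (lookup v i))
        (trans (cong (c *F_) (sym (lookup-diag v i))) (sym (lookup-∙ c (diag v) i)))))
    }

  diag-involutive : ∀ v → diag (diag v) ≡ v
  diag-involutive v = vector-ext λ i → begin
    lookup (diag (diag v)) i                       ≡⟨ lookup-diag (diag v) i ⟩
    lookup d i *F lookup (diag v) i                ≡⟨ cong (lookup d i *F_) (lookup-diag v i) ⟩
    lookup d i *F (lookup d i *F lookup v i)       ≡⟨ sym (*F-assoc (lookup d i) (lookup d i) (lookup v i)) ⟩
    (lookup d i *F lookup d i) *F lookup v i       ≡⟨ cong (_*F lookup v i) (≢0⇒square≡1 (lookup d i) (d≢0 i)) ⟩
    1F *F lookup v i                               ≡⟨ *F-identityˡ (lookup v i) ⟩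
    lookup v i                                     ∎
    where open ≡-Reasoning

  diag-iso : Iso n
  diag-iso = record
    { to = diag ; from = diag ; linear = diag-linear ; to∘from = diag-involutive ; from∘to = diag-involutive }

  diag-unit : ∀ j → diag (unit j) ≡ lookup d j ∙ unit j
  diag-unit j = vector-ext λ i → trans (lookup-diag (unit j) i)
    (trans (at i) (sym (lookup-∙ (lookup d j) (unit j) i)))
    where
    at : ∀ i → lookup d i *F lookup (unit j) i ≡ lookup d j *F lookup (unit j) i
    at i with j ≟ i
    ... | yes refl = refl
    ... | no  j≢i rewrite lookup-unit-≢ j i j≢i = trans (*F-comm (lookup d i) 0F) (*F-comm 0F (lookup d j))

weight-diag : (d v : Vector n) → (∀ i → lookup d i ≢ 0F) → weight (zipWith _*F_ d v) ≡ weight v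
weight-diag []       []       _  = refl
weight-diag (0F ∷ d) (_  ∷ v) d≢0 = contradiction refl (d≢0 zero)
weight-diag (1F ∷ d) (0F ∷ v) d≢0 = weight-diag d v (d≢0 ∘ suc)
weight-diag (1F ∷ d) (1F ∷ v) d≢0 = cong suc (weight-diag d v (d≢0 ∘ suc))
weight-diag (1F ∷ d) (2F ∷ v) d≢0 = cong suc (weight-diag d v (d≢0 ∘ suc))
weight-diag (2F ∷ d) (0F ∷ v) d≢0 = weight-diag d v (d≢0 ∘ suc)
weight-diag (2F ∷ d) (1F ∷ v) d≢0 = cong suc (weight-diag d v (d≢0 ∘ suc))
weight-diag (2F ∷ d) (2F ∷ v) d≢0 = cong suc (weight-diag d v (d≢0 ∘ suc))

*F-cancel-≢0 : ∀ a b → a ≢ 0F → a *F b ≡ 0F → b ≡ 0F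
*F-cancel-≢0 a b a≢0 ab≡0 = decidable-stable (b ≟ 0F) (λ b≢0 → *F-nonzero a b a≢0 b≢0 ab≡0)

lookup-0F≡head : (v : Vector (suc n)) → lookup v zero ≡ head v
lookup-0F≡head (_ ∷ _) = refl

-- Rescaling the rows by d and the columns by scale turns the first row and the first column
-- into ones, apart from their zero in common.
module Normalise (c : Fin 6 → Vector 6) (diagonal : ∀ i → lookup (c i) i ≡ 0F)
  (weight-column : ∀ i → 5 ≤ weight (c i))
  (weight-pair : ∀ i j → i ≢ j → ∀ α γ → α ≢ 0F → 4 ≤ weight (α ∙ c i +ᵥ γ ∙ c j)) where

  zeroExactly : ∀ i → ZeroExactlyAt i (c i)
  zeroExactly i j = weight≥5⇒zero-unique (c i) (weight-column i) i j (diagonal i) , λ { refl → diagonal i }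

  d : Vector 6
  -- Nonzero entries are their own inverses; the zero at the first place is replaced by `1F` to keep
  -- the diagonal matrix invertible.
  d = 1F ∷ tail (c 0F)

  d≢0 : ∀ i → lookup d i ≢ 0F
  d≢0 zero    ()
  d≢0 (suc i) eq with c 0F | zeroExactly 0F (suc i)
  ... | _ ∷ _ | zero⇒ , _ = contradiction (zero⇒ eq) λ ()

  open Diagonal d d≢0

  scale : Fin 6 → F
  scale zero    = 1F
  -- The only zero of this column is at `suc i`, so its first entry is nonzero and its own inverse.
  -- The row scaling `d` leaves that entry unchanged.
  scale (suc i) = head (c (suc i))

  scale≢0 : ∀ i → scale i ≢ 0F
  scale≢0 zero    ()
  scale≢0 (suc i) eq =
    contradiction (proj₁ (zeroExactly (suc i) zero) (trans (lookup-0F≡head (c (suc i))) eq)) λ ()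

  column : Fin 6 → Vector 6
  column i = scale i ∙ diag (c i)

  lookup-column : ∀ i j → lookup (column i) j ≡ scale i *F (lookup d j *F lookup (c i) j)
  lookup-column i j = trans (lookup-∙ (scale i) (diag (c i)) j) (cong (scale i *F_) (lookup-diag (c i) j))

  column-first : column 0F ≡ firstColumn
  column-first = trans (∙-identity (diag (c 0F))) (normalise-first (c 0F) (zeroExactly 0F))

  column-normalised : ∀ i → Normalised (suc i) (column (suc i))
  column-normalised i = head≡1 , λ j →
    (λ eq → proj₁ (zeroExactly (suc i) j) (*F-cancel-≢0 (lookup d j) (lookup (c (suc i)) j) (d≢0 j)
      (*F-cancel-≢0 (scale (suc i)) (lookup d j *F lookup (c (suc i)) j) (scale≢0 (suc i))
        (trans (sym (lookup-column (suc i) j)) eq)))) ,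
    (λ i≡j → trans (lookup-column (suc i) j) (trans
      (cong (λ a → scale (suc i) *F (lookup d j *F a)) (proj₂ (zeroExactly (suc i) j) i≡j))
      (trans (cong (scale (suc i) *F_) (*F-comm (lookup d j) 0F)) (*F-comm (scale (suc i)) 0F))))
    where
    open ≡-Reasoning
    head≡1 : head (column (suc i)) ≡ 1F
    head≡1 = begin
      head (column (suc i))
        ≡⟨ sym (lookup-0F≡head (column (suc i))) ⟩
      lookup (column (suc i)) 0F
        ≡⟨ lookup-column (suc i) 0F ⟩
      scale (suc i) *F (1F *F lookup (c (suc i)) 0F)
        ≡⟨ cong (scale (suc i) *F_) (trans (*F-identityˡ (lookup (c (suc i)) 0F)) (lookup-0F≡head (c (suc i)))) ⟩
      scale (suc i) *F scale (suc i)
        ≡⟨ ≢0⇒square≡1 (scale (suc i)) (scale≢0 (suc i)) ⟩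
      1F ∎

  -- Scaling rows preserves the weight, and scaling columns only changes the coefficients of the
  -- combination.
  column-combination : ∀ i j → i ≢ j → ∀ γ → 4 ≤ weight (column i +ᵥ γ ∙ column j)
  column-combination i j i≢j γ = subst (4 ≤_) (trans (sym (weight-diag d u d≢0)) (cong weight (begin
    diag u
      ≡⟨ +-homo diag-linear (scale i ∙ c i) ((γ *F scale j) ∙ c j) ⟩
    diag (scale i ∙ c i) +ᵥ diag ((γ *F scale j) ∙ c j)
      ≡⟨ cong₂ _+ᵥ_ (∙-homo diag-linear (scale i) (c i)) (trans
           (∙-homo diag-linear (γ *F scale j) (c j)) (∙-assoc γ (scale j) (diag (c j)))) ⟩
    column i +ᵥ γ ∙ column j ∎)))
    (weight-pair i j i≢j (scale i) (γ *F scale j) (scale≢0 i))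
    where
    open ≡-Reasoning
    u = scale i ∙ c i +ᵥ (γ *F scale j) ∙ c j

  column-compatible : ∀ i j → i ≢ j → Compatible (column i) (column j)
  column-compatible i j i≢j =
    subst (λ v → 4 ≤ weight (column i +ᵥ v)) (∙-identity (column j)) (column-combination i j i≢j 1F) ,
    column-combination i j i≢j 2F

  first-compatible : ∀ j → Compatible firstColumn (column (suc j))
  first-compatible j = subst (λ v → Compatible v (column (suc j))) column-first (column-compatible 0F (suc j) λ ())

  columns : Vec (Vector 6) 6
  columns = firstColumn ∷ column 1F ∷ column 2F ∷ column 3F ∷ column 4F ∷ column 5F ∷ []

  lookup-columns : ∀ j → lookup columns j ≡ column j
  lookup-columns 0F = sym column-first
  lookup-columns 1F = refl
  lookup-columns 2F = refl
  lookup-columns 3F = refl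
  lookup-columns 4F = refl
  lookup-columns 5F = refl

  opaque
    relabel : ∃ λ t → ∀ i → ∃ λ j → permute (relabelling t) (lookup conference i) ≡ lookup columns j
    relabel = normalised⇒conference
      (column 1F) (column-normalised 0F) (first-compatible 0F)
      (column 2F) (column-normalised 1F) (first-compatible 1F) (column-compatible 1F 2F λ ())
      (column 3F) (column-normalised 2F) (first-compatible 2F) (column-compatible 1F 3F λ ())
        (column-compatible 2F 3F λ ())
      (column 4F) (column-normalised 3F) (first-compatible 3F) (column-compatible 1F 4F λ ())
        (column-compatible 2F 4F λ ()) (column-compatible 3F 4F λ ())
      (column 5F) (column-normalised 4F) (first-compatible 4F) (column-compatible 1F 5F λ ())
        (column-compatible 2F 5F λ ()) (column-compatible 3F 5F λ ()) (column-compatible 4F 5F λ ())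

  -- The relabelling leads to the normalised columns, from which the self-inverse `diag` removes the
  -- row scaling again.
  monomial : Iso 6
  monomial = diag-iso ∘-iso relabelling-iso (proj₁ relabel)

  monomial-golay : ∀ i → (∃ λ j → Iso.to monomial (lookup golay i) ∼ unit j) ⊎
                         (∃ λ j → Iso.to monomial (lookup golay i) ∼ c j)
  monomial-golay i with golay-unit⊎conference i
  ... | inj₁ (k , eq) with j , eq′ ← permute-unit (proj₁ relabel) k = inj₁ (j , lookup d j , d≢0 j , (begin
    lookup d j ∙ Iso.to monomial (lookup golay i)
      ≡⟨ cong (λ v → lookup d j ∙ Iso.to monomial v) eq ⟩
    lookup d j ∙ diag (permute (relabelling (proj₁ relabel)) (unit k))
      ≡⟨ cong (λ v → lookup d j ∙ diag v) eq′ ⟩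
    lookup d j ∙ diag (unit j)
      ≡⟨ cong (lookup d j ∙_) (diag-unit j) ⟩
    lookup d j ∙ lookup d j ∙ unit j
      ≡⟨ ∙-involutive (lookup d j) (d≢0 j) (unit j) ⟩
    unit j ∎))
    where open ≡-Reasoning
  ... | inj₂ (k , eq) with j , eq′ ← proj₂ relabel k = inj₂ (j , scale j , scale≢0 j , (begin
    scale j ∙ Iso.to monomial (lookup golay i)
      ≡⟨ cong (λ v → scale j ∙ Iso.to monomial v) eq ⟩
    scale j ∙ diag (permute (relabelling (proj₁ relabel)) (lookup conference k))
      ≡⟨ cong (λ v → scale j ∙ diag v) (trans eq′ (lookup-columns j)) ⟩
    scale j ∙ diag (scale j ∙ diag (c j))
      ≡⟨ cong (scale j ∙_) (∙-homo diag-linear (scale j) (diag (c j))) ⟩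
    scale j ∙ scale j ∙ diag (diag (c j))
      ≡⟨ ∙-involutive (scale j) (scale≢0 j) (diag (diag (c j))) ⟩
    diag (diag (c j))
      ≡⟨ diag-involutive (c j) ⟩
    c j ∎))
    where open ≡-Reasoning

  opaque
    golay-normalForm : ∃ λ (M : Iso 6) → ∀ i →
      (∃ λ j → Iso.to M (lookup golay i) ∼ unit j) ⊎ (∃ λ j → Iso.to M (lookup golay i) ∼ c j)
    golay-normalForm = monomial , monomial-golay

-- The frame of a design and the coordinates of its other points

module Frame (vs : Vec (Vector 6) 12) (short : ShortRelationsTrivial 5 vs)
  (sixth-point : (f : Fin 5 → Fin 12) → Injective _≡_ _≡_ f →
    ∃ λ m → LinearlyIndependent (lookup vs m ∷ tabulate (lookup vs ∘ f)))
  (block-in-span : (f : Fin 5 → Fin 12) → Injective _≡_ _≡_ f → ∃ λ m →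
    (∀ i → f i ≢ m) × InSpan (tabulate (lookup vs ∘ f)) (lookup vs m)) where

  f₀ : Fin 5 → Fin 12
  f₀ i = suc (i ↑ˡ 6)

  f₀-injective : Injective _≡_ _≡_ f₀
  f₀-injective = ↑ˡ-injective 6 _ _ ∘ suc-injective

  -- The frame consists of the points β i; the hyperplane spanned by all of them except β i
  -- contains exactly one more point, σ i, whose coordinate vector is c i.
  β : Fin 6 → Fin 12
  β zero    = proj₁ (sixth-point f₀ f₀-injective)
  β (suc i) = f₀ i

  us : Vec (Vector 6) 6
  us = tabulate (lookup vs ∘ β)

  frame : Iso 6
  frame = independent⇒iso us (proj₂ (sixth-point f₀ f₀-injective))

  module L = Iso frame

  L-unit : ∀ i → L.to (unit i) ≡ lookup vs (β i)
  L-unit i = trans (linComb-unit i us) (lookup∘tabulate (lookup vs ∘ β) i)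

  β-injective : Injective _≡_ _≡_ β
  β-injective {i} {j} eq with i ≟ j
  ... | yes i≡j = i≡j
  ... | no  i≢j = contradiction (begin
    1F                 ≡⟨ sym (lookup-unit-≡ i) ⟩
    lookup (unit i) i  ≡⟨ cong (λ v → lookup v i) (L.to-injective {unit i} {unit j}
                            (trans (L-unit i) (trans (cong (lookup vs) eq) (sym (L-unit j))))) ⟩
    lookup (unit j) i  ≡⟨ lookup-unit-≢ j i (i≢j ∘ sym) ⟩
    0F                 ∎) λ ()
    where open ≡-Reasoning

  face : Fin 6 → Fin 5 → Fin 12
  face i = β ∘ punchIn i

  face-injective : ∀ i → Injective _≡_ _≡_ (face i)
  face-injective i = punchIn-injective i _ _ ∘ β-injective

  σ : Fin 6 → Fin 12
  σ i = proj₁ (block-in-span (face i) (face-injective i))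

  coefficients : Fin 6 → Vector 5
  coefficients i = proj₁ (proj₂ (proj₂ (block-in-span (face i) (face-injective i))))

  c : Fin 6 → Vector 6
  c i = scatter (punchIn i) (coefficients i)

  L-c : ∀ i → L.to (c i) ≡ lookup vs (σ i)
  L-c i = begin
    linComb (scatter (punchIn i) (coefficients i)) us
      ≡⟨ linComb-scatter (punchIn i) (coefficients i) us ⟩
    linComb (coefficients i) (tabulate (lookup us ∘ punchIn i))
      ≡⟨ cong (linComb (coefficients i)) (tabulate-cong (λ j → lookup∘tabulate (lookup vs ∘ β) (punchIn i j))) ⟩
    linComb (coefficients i) (tabulate (lookup vs ∘ face i))
      ≡⟨ proj₂ (proj₂ (proj₂ (block-in-span (face i) (face-injective i)))) ⟩
    lookup vs (σ i) ∎
    where open ≡-Reasoning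

  c-diagonal : ∀ i → lookup (c i) i ≡ 0F
  c-diagonal i = lookup-scatter-∉ (punchIn i) (coefficients i) i (punchInᵢ≢i i)

  -- Points of the face are excluded by `block-in-span`. The remaining point `β i` has coordinate 1
  -- at `i`, where `c i` vanishes.
  σ∉β : ∀ i j → β j ≢ σ i
  σ∉β i j eq with i ≟ j
  ... | no  i≢j = proj₁ (proj₂ (block-in-span (face i) (face-injective i))) (punchOut i≢j)
                    (trans (cong β (punchIn-punchOut i≢j)) eq)
  ... | yes refl = contradiction (begin
    1F                 ≡⟨ sym (lookup-unit-≡ i) ⟩
    lookup (unit i) i  ≡⟨ cong (λ v → lookup v i) (L.to-injective {unit i} {c i}
                            (trans (L-unit i) (trans (cong (lookup vs) eq) (sym (L-c i))))) ⟩
    lookup (c i) i     ≡⟨ c-diagonal i ⟩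
    0F                 ∎) λ ()
    where open ≡-Reasoning

  -- One vector is written twice, through all twelve by `y` and through the frame by `x`. The
  -- difference is a relation of weight at most five, so `y` is supported on the frame, which misses
  -- `σ i`.
  short-coordinates : ∀ x y → L.to x ≡ linComb y vs → weight y ℕ.+ weight x ≤ 5 →
                      ∀ i → lookup y (σ i) ≡ 0F
  short-coordinates x y eq bound i = begin
    lookup y (σ i)               ≡⟨ cong (λ v → lookup v (σ i)) (+ᵥ-2∙-cancel y (scatter β x) (short rel rel≡0 rel-short)) ⟩
    lookup (scatter β x) (σ i)   ≡⟨ lookup-scatter-∉ β x (σ i) (σ∉β i) ⟩
    0F                           ∎
    where
    open ≡-Reasoning
    rel = y +ᵥ 2F ∙ scatter β x
    rel≡0 : linComb rel vs ≡ 0ᵥ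
    rel≡0 = begin
      linComb rel vs
        ≡⟨ +-homo (linComb-linear vs) y (2F ∙ scatter β x) ⟩
      linComb y vs +ᵥ linComb (2F ∙ scatter β x) vs
        ≡⟨ cong₂ _+ᵥ_ (sym eq) (trans (∙-homo (linComb-linear vs) 2F (scatter β x))
                                      (cong (2F ∙_) (linComb-scatter β x vs))) ⟩
      L.to x +ᵥ 2F ∙ L.to x
        ≡⟨ +ᵥ-2∙-inverse (L.to x) ⟩
      0ᵥ ∎
    rel-short : weight rel ≤ 5
    rel-short = ℕ.≤-trans (weight-+ y (2F ∙ scatter β x)) (ℕ.≤-trans (ℕ.+-monoʳ-≤ (weight y)
      (ℕ.≤-trans (weight-∙ 2F (scatter β x)) (weight-scatter β x))) bound)

  -- Expressing the point `σ i` in the frame is a relation with one place more than the weight of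
  -- `c i`; a weight below five would make it too short.
  c-weight : ∀ i → 5 ≤ weight (c i)
  c-weight i = ℕ.≮⇒≥ λ w<5 → contradiction
    (trans (sym (lookup-unit-≡ (σ i))) (short-coordinates (c i) (unit (σ i))
      (trans (L-c i) (sym (linComb-unit (σ i) vs)))
      (subst (λ w → w ℕ.+ weight (c i) ≤ 5) (sym (weight-unit (σ i))) w<5) i)) λ ()

  -- Equal points have equal coordinate vectors, and the single zero of such a vector determines the
  -- index.
  σ-injective : Injective _≡_ _≡_ σ
  σ-injective {i} {j} eq = weight≥5⇒zero-unique (c i) (c-weight i) i j (c-diagonal i)
    (trans (cong (λ v → lookup v j) (L.to-injective {c i} {c j}
      (trans (L-c i) (trans (cong (lookup vs) eq) (sym (L-c j)))))) (c-diagonal j))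

  -- The same argument with two points outside the frame: two places for them leave room for at most
  -- three frame points in a forbidden relation.
  c-weight-pair : ∀ i j → i ≢ j → ∀ α γ → α ≢ 0F → 4 ≤ weight (α ∙ c i +ᵥ γ ∙ c j)
  c-weight-pair i j i≢j α γ α≢0 = ℕ.≮⇒≥ λ w<4 → α≢0 (begin
    α
      ≡⟨ sym (+F-identityʳ α) ⟩
    α +F 0F
      ≡⟨ cong₂ _+F_ (trans (sym (*F-identityˡ α)) (trans (*F-comm 1F α) (cong (α *F_) (sym (lookup-unit-≡ (σ i))))))
           (trans (*F-comm 0F γ) (cong (γ *F_) (sym (lookup-unit-≢ (σ j) (σ i) (i≢j ∘ sym ∘ σ-injective))))) ⟩
    α *F lookup (unit (σ i)) (σ i) +F γ *F lookup (unit (σ j)) (σ i)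
      ≡⟨ sym (trans (lookup-+ (α ∙ unit (σ i)) (γ ∙ unit (σ j)) (σ i))
           (cong₂ _+F_ (lookup-∙ α (unit (σ i)) (σ i)) (lookup-∙ γ (unit (σ j)) (σ i)))) ⟩
    lookup y (σ i)
      ≡⟨ short-coordinates x y x≡y (ℕ.+-mono-≤ y-short (ℕ.≤-pred w<4)) i ⟩
    0F ∎)
    where
    open ≡-Reasoning
    x = α ∙ c i +ᵥ γ ∙ c j
    y = α ∙ unit (σ i) +ᵥ γ ∙ unit (σ j)
    y-short : weight y ≤ 2
    y-short = ℕ.≤-trans (weight-+ (α ∙ unit (σ i)) (γ ∙ unit (σ j)))
                (ℕ.+-mono-≤ (weight-∙unit α (σ i)) (weight-∙unit γ (σ j)))
    V = linComb-linear vs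
    x≡y : L.to x ≡ linComb y vs
    x≡y = begin
      L.to x
        ≡⟨ +-homo L.linear (α ∙ c i) (γ ∙ c j) ⟩
      L.to (α ∙ c i) +ᵥ L.to (γ ∙ c j)
        ≡⟨ cong₂ _+ᵥ_ (trans (∙-homo L.linear α (c i)) (cong (α ∙_) (trans (L-c i) (sym (linComb-unit (σ i) vs)))))
                      (trans (∙-homo L.linear γ (c j)) (cong (γ ∙_) (trans (L-c j) (sym (linComb-unit (σ j) vs))))) ⟩
      α ∙ linComb (unit (σ i)) vs +ᵥ γ ∙ linComb (unit (σ j)) vs
        ≡⟨ sym (trans (+-homo V (α ∙ unit (σ i)) (γ ∙ unit (σ j)))
                      (cong₂ _+ᵥ_ (∙-homo V α (unit (σ i))) (∙-homo V γ (unit (σ j))))) ⟩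
      linComb y vs ∎

  opaque
    golayFrame : ∃ λ (G : Iso 6) → ∀ i → ∃ λ m → Iso.to G (lookup golay i) ∼ lookup vs m
    golayFrame with M , M-golay ← Normalise.golay-normalForm c c-diagonal c-weight c-weight-pair =
      frame ∘-iso M , λ i → member M i (M-golay i)
      where
      member : ∀ M i → (∃ λ j → Iso.to M (lookup golay i) ∼ unit j) ⊎ (∃ λ j → Iso.to M (lookup golay i) ∼ c j) →
               ∃ λ m → L.to (Iso.to M (lookup golay i)) ∼ lookup vs m
      member M i (inj₁ (j , a , a≢0 , eq)) = β j , a , a≢0 ,
        trans (sym (∙-homo L.linear a (Iso.to M (lookup golay i)))) (trans (cong L.to eq) (L-unit j))
      member M i (inj₂ (j , a , a≢0 , eq)) = σ j , a , a≢0 ,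
        trans (sym (∙-homo L.linear a (Iso.to M (lookup golay i)))) (trans (cong L.to eq) (L-c j))

-- The induced map between the two index sets of twelve elements is injective, hence onto.
golay-⊆⇒≐ : (L : Iso 6) {K : Pred (Point 5) 0ℓ} (p : Fin 12 → Point 5) → K ≐ ⟦ p ⟧ →
            (∀ i → ∃ λ m → golayPoint L i ≈ p m) → K ≐ ⟦ golayPoint L ⟧
golay-⊆⇒≐ L {K} p K≐ golay-⊆ = K⊆ , ⊆K
  where
  q = golayPoint L
  g : Fin 12 → Fin 12
  g i = proj₁ (golay-⊆ i)
  q≈ : ∀ i → q i ≈ p (g i)
  q≈ i = proj₂ (golay-⊆ i)
  g-injective : Injective _≡_ _≡_ g
  g-injective {i} {j} eq = golayPoint-distinct L {i} {j} (≈-trans (q i) (p (g j)) (q j)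
    (subst (λ k → q i ≈ p k) eq (q≈ i)) (≈-sym (q j) (p (g j)) (q≈ j)))
  K⊆ : K ⊆ ⟦ q ⟧
  K⊆ {P} P∈K with m , eq ← proj₁ K≐ P∈K with i , refl ← Fin-injective⇒surjective g g-injective m =
    i , ≈-trans (q i) (p (g i)) P (q≈ i) eq
  ⊆K : ⟦ q ⟧ ⊆ K
  ⊆K {P} (i , eq) = proj₂ K≐ {P}
    (g i , ≈-trans (p (g i)) (q i) P (≈-sym (q i) (p (g i)) (q≈ i)) eq)

module _ (K : Pred (Point 5) 0ℓ) (design : IsSteinerDesign (PG 5) 5 12 6 K (𝓑 K))
  (vs : Vec (Vector 6) 12) (nonzero : ∀ i → lookup vs i ≢ 0ᵥ) where

  open DesignFrame K design vs nonzero

  enumeration⇒golay : Distinct point → K ≐ ⟦ point ⟧ → ∃ λ (L : Iso 6) → K ≐ ⟦ golayPoint L ⟧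
  enumeration⇒golay distinct K≐ = proj₁ G , golay-⊆⇒≐ (proj₁ G) point K≐ (proj₂ G)
    where
    G : ∃ λ (L : Iso 6) → ∀ i → ∃ λ m → golayPoint L i ≈ point m
    G = Frame.golayFrame vs (shortRelations distinct K≐) (sixth-point distinct K≐) (block-in-span distinct K≐)

opaque
  design⇒golay : (K : Pred (Point 5) 0ℓ) → IsSteinerDesign (PG 5) 5 12 6 K (𝓑 K) →
                 ∃ λ (L : Iso 6) → K ≐ ⟦ golayPoint L ⟧
  design⇒golay K design = enumeration⇒golay K design vs nonzero (λ {i} {j} → distinct {i} {j}) K≐
    where
    open IsSteinerDesign design
    e : Fin 12 → Point 5
    e = element points-size
    vs : Vec (Vector 6) 12
    vs = tabulate (proj₁ ∘ e)
    nonzero : ∀ i → lookup vs i ≢ 0ᵥ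
    nonzero i eq = proj₂ (e i) (trans (sym (lookup∘tabulate (proj₁ ∘ e) i)) eq)
    point : Fin 12 → Point 5
    point i = lookup vs i , nonzero i
    point≈e : ∀ i → point i ≈ e i
    point≈e i = 1F , (λ ()) , trans (∙-identity (lookup vs i)) (lookup∘tabulate (proj₁ ∘ e) i)
    distinct : Distinct point
    distinct {i} {j} eq = element-distinct points-size {i} {j}
      (≈-trans (e i) (point j) (e j) (≈-trans (e i) (point i) (point j) (≈-sym (point i) (e i) (point≈e i)) eq)
        (point≈e j))
    K≐ : K ≐ ⟦ point ⟧
    K≐ = (λ {P} P∈K → let i , eq = ⊆-⟦element⟧ points-size P∈K in
            i , ≈-trans (point i) (e i) P (point≈e i) eq) ,
         (λ {P} (i , eq) → respects {e i} {P}
            (≈-trans (e i) (point i) P (≈-sym (point i) (e i) (point≈e i)) eq) (element-∈ points-size i))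

-- Collineations induced by linear maps, and uniqueness

module _ (L : Iso (suc n)) where
  open Iso L

  projectivity : Point n → Point n
  projectivity (v , v≢0) = to v , to-≢0 v≢0

  projectivity-cong : (P Q : Point n) → P ≈ Q → projectivity P ≈ projectivity Q
  projectivity-cong (u , _) (_ , _) (c , c≢0 , refl) = c , c≢0 , sym (∙-homo linear c u)

  collineation : Collineation n
  collineation = record
    { bijection = record
      { to        = projectivity
      ; cong      = λ {P} {Q} → projectivity-cong P Q
      ; bijective =
          (λ { {u , _} (c , c≢0 , eq) → c , c≢0 , to-injective (trans (∙-homo linear c u) eq) }) ,
          λ Q@(v , v≢0) → preimage Q , λ {P} P≈ →
            ≈-trans (projectivity P) (projectivity (preimage Q)) Q (projectivity-cong P (preimage Q) P≈)
              (1F , (λ ()) , trans (∙-identity (to (from v))) (to∘from v))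
      }
    ; line-image = λ l → image l , image-points l
    }
    where
    preimage : Point n → Point n
    preimage (v , v≢0) = from v , Iso.to-≢0 (flip-iso L) v≢0

    image : ∀ {d} → Flat n d → Flat n d
    image l = record
      { basis       = map to (Flat.basis l)
      ; independent = λ cs eq → Flat.independent l cs (to-injective
          (trans (linComb-homo linear cs (Flat.basis l)) (trans eq (sym (0-homo linear)))))
      }

    image-points : (l : Line n) → Image projectivity (points l) ≐ points (image l)
    image-points l =
      (λ { {Q} (P@(_ , _) , (cs , refl) , LP≈Q) →
           points-respects (image l) {projectivity P} {Q} LP≈Q
             (cs , sym (linComb-homo linear cs (Flat.basis l))) }) ,
      (λ { {Q@(v , v≢0)} (cs , eq) → preimage Q ,
           (cs , to-injective (trans (linComb-homo linear cs (Flat.basis l)) (trans eq (sym (to∘from v))))) ,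
           1F , (λ ()) , trans (∙-identity (to (from v))) (to∘from v) })

-- The inverse of `L₁` followed by `L₂` matches the two sets point by point through their common
-- standard form.
golay-unique : (L₁ L₂ : Iso 6) {K₁ K₂ : Pred (Point 5) 0ℓ} →
               K₁ ≐ ⟦ golayPoint L₁ ⟧ → K₂ ≐ ⟦ golayPoint L₂ ⟧ →
               ∃ λ (κ : Collineation 5) → Image (Collineation.to κ) K₁ ≐ K₂
golay-unique L₁ L₂ {K₁} {K₂} K₁≐ K₂≐ = collineation M , image⊆ , ⊆image
  where
  M  = L₂ ∘-iso flip-iso L₁
  p₁ = golayPoint L₁
  p₂ = golayPoint L₂
  M-p : ∀ i → projectivity M (p₁ i) ≈ p₂ i
  M-p i = 1F , (λ ()) , trans (∙-identity (Iso.to L₂ (Iso.from L₁ (Iso.to L₁ (lookup golay i)))))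
                          (cong (Iso.to L₂) (Iso.from∘to L₁ (lookup golay i)))
  image⊆ : Image (projectivity M) K₁ ⊆ K₂
  image⊆ {Q} (P , P∈ , MP≈Q) = let i , eq = proj₁ K₁≐ P∈ in proj₂ K₂≐ {Q} (i ,
    ≈-trans (p₂ i) (projectivity M (p₁ i)) Q (≈-sym (projectivity M (p₁ i)) (p₂ i) (M-p i))
      (≈-trans (projectivity M (p₁ i)) (projectivity M P) Q (projectivity-cong M (p₁ i) P eq) MP≈Q))
  ⊆image : K₂ ⊆ Image (projectivity M) K₁
  ⊆image {Q} Q∈ = let i , eq = proj₁ K₂≐ Q∈ in
    p₁ i , proj₂ K₁≐ {p₁ i} (i , ≈-refl (p₁ i)) , ≈-trans (projectivity M (p₁ i)) (p₂ i) Q (M-p i) eq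

mainTheorem3 : (l∞ : Line 2) →
    IsSteinerDesign (PG 5) 5 12 6 (𝓚 l∞) (𝓑 (𝓚 l∞)) ×
    ((K′ : Pred (Point 5) 0ℓ) → K′ Respects _≈_ →
    IsSteinerDesign (PG 5) 5 12 6 K′ (𝓑 K′) →
    ∃ λ (κ : Collineation 5) → Image (Collineation.to κ) (𝓚 l∞) ≐ K′)
mainTheorem3 l∞ =
  golay-isDesign (proj₁ (𝓚-golay l∞)) (𝓚 l∞) (proj₂ (𝓚-golay l∞)) ,
  λ K′ _ design → golay-unique (proj₁ (𝓚-golay l∞)) (proj₁ (design⇒golay K′ design))
    (proj₂ (𝓚-golay l∞)) (proj₂ (design⇒golay K′ design))
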